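{- Let $\Sigma$ be a finite simplicial complex and $d\ge0$, with $\deg\tau>0$ for all $\tau\in\Sigma_d$. Define $$h(\Sigma_d)=\inf_{\mathbf{x}\in\mathbb{R}^{\Sigma_d}\setminus\mathrm{Im}(B_d^\top)}\frac{\|B_{d+1}^\top\mathbf{x}\|_1}{\inf_{\mathbf{z}\in\mathrm{Im}(B_d^\top)}\|\mathbf{x}+\mathbf{z}\|_{1,\deg}}.$$ Then the following hold. (i) The infimum is attained at an integer vector: $$h(\Sigma_d)=\min_{\mathbf{x}\in\mathbb{Z}^{\Sigma_d}\setminus\mathrm{Im}(B_d^\top)}\frac{\|B_{d+1}^\top\mathbf{x}\|_1}{\inf_{\mathbf{z}\in\mathrm{Im}(B_d^\top)}\|\mathbf{x}+\mathbf{z}\|_{1,\deg}}.$$ (ii) We have $$h(\Sigma_d)=\min_{\mathbf{x}\neq0,\ \mathbf{x}\perp^1\mathrm{Im}(B_d^\top)}\frac{\|B_{d+1}^\top\mathbf{x}\|_1}{\|\mathbf{x}\|_{1,\deg}}.$$ (iii) $h(\Sigma_d)=0$ if and only if $\tilde H^d(\Sigma,\mathbb{R})\neq0$. (iv) If $\tilde H^d(\Sigma,\mathbb{R})=0$, then $$h(\Sigma_d)=\min_{\mathbf{y}\in\mathrm{Im}(\delta_d)\setminus\{0\}}\frac{\|\mathbf{y}\|_1}{\|\mathbf{y}\|_{\mathrm{fil}}}=\frac{1}{\max_{\mathbf{y}\in\mathrm{Im}(\delta_d)\setminus\{0\}}\|\mathbf{y}\|_{\mathrm{fil}}/\|\mathbf{y}\|_1},$$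 where $\|\mathbf{y}\|_{\mathrm{fil}}=\inf\{\|\mathbf{x}\|_{1,\deg}:\mathbf{x}\in\mathbb{R}^{\Sigma_d},\ \delta_d\mathbf{x}=\mathbf{y}\}$.
   Context: $\Sigma_d$ is the set of $d$-simplices of $\Sigma$ with fixed orientations. $B_{d+1}$ is the $\Sigma_d\times\Sigma_{d+1}$ matrix with entries $\mathrm{sgn}([\tau],\partial[\sigma])\in\{\pm1\}$ when $\tau$ is a facet of $\sigma$ and $0$ otherwise; the coboundary is $\delta_d=B_{d+1}^\top:\mathbb{R}^{\Sigma_d}\to\mathbb{R}^{\Sigma_{d+1}}$. For $d\ge1$, $B_d^\top=\delta_{d-1}:\mathbb{R}^{\Sigma_{d-1}}\to\mathbb{R}^{\Sigma_d}$. For $d=0$, $B_0^\top:\mathbb{R}\to\mathbb{R}^{\Sigma_0}$ maps $c$ to the constant function $c$, so $\mathrm{Im}(B_0^\top)$ consists of the constants. $\mathrm{Im}(B_d^\top)$ always denotes the real image. $\deg\tau$ is the number of $(d+1)$-simplices containing $\tau$. The norms are $\|\mathbf{x}\|_{1,\deg}=\sum_{\tau\in\Sigma_d}\deg\tau\,|x_\tau|$ and $\|\mathbf{y}\|_1=\sum_{\sigma\in\Sigma_{d+1}}|y_\sigma|$. $\nabla$ denotes the convex subdifferential. We write $\mathbf{x}\perp^1 Y$ if there exists $\mathbf{u}\in\nabla\|\mathbf{x}\|_{1,\deg}$ with $\langle\mathbf{u},\mathbf{y}\rangle=0$ for all $\mathbf{y}\in Y$ (standard inner product). $\tilde H^d(\Sigma,\mathbb{R})$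 is the reduced real simplicial cohomology; it is nonzero iff $\mathrm{Im}(B_d^\top)\subsetneq\mathrm{Ker}(B_{d+1}^\top)$. -}

module Defs where

open import Level using (Level; _⊔_; 0ℓ) renaming (suc to lsuc)
open import Algebra.Bundles using (CommutativeRing)
import Algebra.Construct.NaturalChoice.Max as Max
import Algebra.Definitions.RawMonoid as RawMonoid
open import Data.Fin.Base using (Fin)
import Data.Fin.Properties as Fin
open import Data.Fin.Subset using (Subset; inside; outside; ∣_∣; Nonempty; _∈_; _⊆_; _-_)
open import Data.Fin.Subset.Properties using (_∈?_; _⊆?_)
open import Data.Integer.Base using (ℤ; +_; -[1+_])
open import Data.List.Base using (List; []; _∷_; _++_; map; filter; length; lookup; allFin)
open import Data.Nat.Base as ℕ using (ℕ; zero; suc)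
import Data.Nat.Properties as ℕ
open import Data.Product.Base using (∃; _×_; _,_)
open import Data.Sign.Base as Sign using (Sign)
import Data.Bool.Properties as Bool
open import Data.Vec.Base using ([]; _∷_)
open import Data.Vec.Functional using (Vector)
import Data.Vec.Properties as Vec
open import Relation.Binary.Bundles using (TotalOrder)
open import Relation.Binary.Core using (Rel)
open import Relation.Binary.Structures using (IsDecTotalOrder)
open import Relation.Binary.PropositionalEquality.Core using (_≡_)
open import Relation.Nullary using (¬_; Dec; yes; no)
open import Relation.Nullary.Decidable using (_×-dec_)
open import Relation.Unary using (Pred; Decidable; Satisfiable; _⊂_)
  renaming (_∈_ to _∈ₚ_; _⊆_ to _⊆ₚ_)

module Bounds {c ℓ} {A : Set c} (_≤_ : Rel A ℓ) where

  IsLowerBound : ∀ {p} → Pred A p → A → Set (c ⊔ ℓ ⊔ p)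
  IsLowerBound S b = ∀ s → s ∈ₚ S → b ≤ s

  IsUpperBound : ∀ {p} → Pred A p → A → Set (c ⊔ ℓ ⊔ p)
  IsUpperBound S b = ∀ s → s ∈ₚ S → s ≤ b

  IsInfimum : ∀ {p} → Pred A p → A → Set (c ⊔ ℓ ⊔ p)
  IsInfimum S m = IsLowerBound S m × (∀ b → IsLowerBound S b → b ≤ m)

  IsMinimum : ∀ {p} → Pred A p → A → Set (c ⊔ ℓ ⊔ p)
  IsMinimum S m = m ∈ₚ S × IsLowerBound S m

  IsMaximum : ∀ {p} → Pred A p → A → Set (c ⊔ ℓ ⊔ p)
  IsMaximum S m = m ∈ₚ S × IsUpperBound S m

-- The classical axioms for the real numbers, which determine them up to
-- isomorphism. Equality is the setoid equality of the ring. The order is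
-- decidable, as it is for the classical reals, so the record cannot be
-- inhabited by a constructive model of ℝ.
record CompleteOrderedField c ℓ₁ ℓ₂ : Set (lsuc (c ⊔ ℓ₁ ⊔ ℓ₂)) where
  field
    commutativeRing : CommutativeRing c ℓ₁

  open CommutativeRing commutativeRing public

  infix 4 _≤_

  field
    _≤_             : Rel Carrier ℓ₂
    isDecTotalOrder : IsDecTotalOrder _≈_ _≤_
    +-monoˡ-≤       : ∀ z {x y} → x ≤ y → x + z ≤ y + z
    *-nonNegative   : ∀ {x y} → 0# ≤ x → 0# ≤ y → 0# ≤ x * y
    0≉1             : ¬ 0# ≈ 1#
    inverse         : ∀ x → ¬ x ≈ 0# → ∃ λ y → x * y ≈ 1#

  open Bounds _≤_ public

  field
    complete : (S : Pred Carrier (c ⊔ ℓ₁ ⊔ ℓ₂)) →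
               Satisfiable S → ∃ (IsLowerBound S) → ∃ (IsInfimum S)

  totalOrder : TotalOrder c ℓ₁ ℓ₂
  totalOrder = record
    { isTotalOrder = IsDecTotalOrder.isTotalOrder isDecTotalOrder }

  open Max totalOrder public using () renaming (_⊔_ to max)

  abs : Carrier → Carrier
  abs x = max x (- x)

  open RawMonoid +-rawMonoid public using (sum) renaming (_×_ to _·_)

  fromℕ : ℕ → Carrier
  fromℕ k = k · 1#

  fromℤ : ℤ → Carrier
  fromℤ (+ k)      = fromℕ k
  fromℤ (-[1+ k ]) = - fromℕ (suc k)

  fromSign : Sign → Carrier
  fromSign Sign.+ = 1#
  fromSign Sign.- = - 1#

  -- IsQuotient a b r: the quotient a / b is defined and equal to r.
  IsQuotient : Carrier → Carrier → Carrier → Set ℓ₁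
  IsQuotient a b r = ¬ b ≈ 0# × r * b ≈ a

-- A finite simplicial complex, its vertices being among the elements of Fin n.
record SimplicialComplex (n : ℕ) : Set₁ where
  field
    IsFace      : Pred (Subset n) 0ℓ
    isFace?     : Decidable IsFace
    nonempty    : ∀ {σ} → IsFace σ → Nonempty σ
    down-closed : ∀ {σ τ} → IsFace σ → τ ⊆ σ → Nonempty τ → IsFace τ

-- An orientation of a simplex is a class of orderings of its vertices modulo
-- even permutations. It is recorded by its sign relative to the increasing
-- ordering, so + is forced on a vertex. Values on subsets that are not faces
-- play no role.
record Orientation (n : ℕ) : Set where
  field
    sign   : Subset n → Sign
    vertex : ∀ {σ} → ∣ σ ∣ ≡ 1 → sign σ ≡ Sign.+

allSubsets : ∀ n → List (Subset n)
allSubsets zero    = [] ∷ []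
allSubsets (suc n) = map (inside ∷_) (allSubsets n) ++ map (outside ∷_) (allSubsets n)

position : ∀ {n} → Subset n → Fin n → ℕ
position {n} σ v = length (filter (λ w → (w ∈? σ) ×-dec (w Fin.<? v)) (allFin n))

infix 8 -1^_

-1^_ : ℕ → Sign
-1^ zero  = Sign.+
-1^ suc k = Sign.opposite (-1^ k)

IsFacet : ∀ {n} → Subset n → Subset n → Set
IsFacet τ σ = ∃ λ v → v ∈ σ × σ - v ≡ τ

isFacet? : ∀ {n} (τ σ : Subset n) → Dec (IsFacet τ σ)
isFacet? τ σ = Fin.any? λ v → (v ∈? σ) ×-dec Vec.≡-dec Bool._≟_ (σ - v) τ

module Cochains
  {c ℓ₁ ℓ₂ : Level} (ℝ : CompleteOrderedField c ℓ₁ ℓ₂)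
  {n : ℕ} (K : SimplicialComplex n) (ω : Orientation n) where

  open CompleteOrderedField ℝ
  open SimplicialComplex K
  open Orientation ω

  simplices : ℕ → List (Subset n)
  simplices d = filter (λ σ → isFace? σ ×-dec (∣ σ ∣ ℕ.≟ suc d)) (allSubsets n)

  -- The d-simplices are indexed by their place in the (duplicate-free) list
  -- simplices d, so that ℝ^Σ_d is Vector Carrier (# d).
  # : ℕ → ℕ
  # d = length (simplices d)

  simplex : ∀ d → Fin (# d) → Subset n
  simplex d = lookup (simplices d)

  Cochain : ℕ → Set c
  Cochain d = Vector Carrier (# d)

  -- With ∂[v₀,…,vₖ] = Σᵢ (-1)ⁱ [v₀,…,v̂ᵢ,…,vₖ] for v₀ < … < vₖ, the
  -- coefficient is corrected by the signs of the chosen orientations.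
  incidence : Subset n → Subset n → Carrier
  incidence τ σ with isFacet? τ σ
  ... | yes (v , _) = fromSign (sign τ Sign.* sign σ Sign.* -1^ (position σ v))
  ... | no _        = 0#

  -- B d is the matrix B_{d+1} of the coboundary δ d.
  B : ∀ d → Fin (# d) → Fin (# (suc d)) → Carrier
  B d τ σ = incidence (simplex d τ) (simplex (suc d) σ)

  δ : ∀ d → Cochain d → Cochain (suc d)
  δ d x σ = sum λ τ → B d τ σ * x τ

  infix 4 _≋_
  infixl 6 _⊕_ _⊖_

  _≋_ : ∀ {k} → Rel (Vector Carrier k) ℓ₁
  x ≋ y = ∀ i → x i ≈ y i

  𝟎 : ∀ {k} → Vector Carrier k
  𝟎 _ = 0#

  _⊕_ _⊖_ : ∀ {k} → Vector Carrier k → Vector Carrier k → Vector Carrier k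
  (x ⊕ y) i = x i + y i
  (x ⊖ y) i = x i + - y i

  ⟨_,_⟩ : ∀ {k} → Vector Carrier k → Vector Carrier k → Carrier
  ⟨ x , y ⟩ = sum λ i → x i * y i

  -- Im d is the image of B_dᵀ, which for d = 0 consists of the constants.
  Im : ∀ d → Pred (Cochain d) (c ⊔ ℓ₁)
  Im zero    x = ∃ λ (a : Carrier) → x ≋ λ _ → a
  Im (suc d) x = ∃ λ (w : Cochain d) → x ≋ δ d w

  Ker : ∀ d → Pred (Cochain d) ℓ₁
  Ker d x = δ d x ≋ 𝟎

  -- The reduced cohomology in degree d is Ker d / Im d.
  CohomologyNonzero : ℕ → Set (c ⊔ ℓ₁)
  CohomologyNonzero d = Im d ⊂ Ker d

  CohomologyZero : ℕ → Set (c ⊔ ℓ₁)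
  CohomologyZero d = Ker d ⊆ₚ Im d

  deg : ∀ d → Fin (# d) → ℕ
  deg d τ = length (filter (simplex d τ ⊆?_) (simplices (suc d)))

  ‖_‖₁ : ∀ {k} → Vector Carrier k → Carrier
  ‖ y ‖₁ = sum λ i → abs (y i)

  -- ‖_‖_{1,deg}; the explicit d is needed since it is not determined by # d.
  degNorm : ∀ d → Cochain d → Carrier
  degNorm d x = sum λ τ → fromℕ (deg d τ) * abs (x τ)

  ∇ : ∀ {k} → (Vector Carrier k → Carrier) → Vector Carrier k →
      Pred (Vector Carrier k) (c ⊔ ℓ₂)
  ∇ f x u = ∀ y → f x + ⟨ u , y ⊖ x ⟩ ≤ f y

  -- x ⊥¹ Y
  Perp¹ : ∀ {p} d → Cochain d → Pred (Cochain d) p → Set (c ⊔ ℓ₁ ⊔ ℓ₂ ⊔ p)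
  Perp¹ d x Y = ∃ λ u → u ∈ₚ ∇ (degNorm d) x × (∀ y → y ∈ₚ Y → ⟨ u , y ⟩ ≈ 0#)

  IsIntegral : ∀ {k} → Pred (Vector Carrier k) ℓ₁
  IsIntegral {k} x = ∃ λ (a : Vector ℤ k) → x ≋ λ i → fromℤ (a i)

  -- m is the infimum over z ∈ Im d in the denominator of the Cheeger ratio.
  IsDist : ∀ d → Cochain d → Carrier → Set (c ⊔ ℓ₁ ⊔ ℓ₂)
  IsDist d x = IsInfimum λ r → ∃ λ z → z ∈ₚ Im d × r ≈ degNorm d (x ⊕ z)

  -- m = ‖y‖_fil
  IsFil : ∀ d → Cochain (suc d) → Carrier → Set (c ⊔ ℓ₁ ⊔ ℓ₂)
  IsFil d y = IsInfimum λ r → ∃ λ x → δ d x ≋ y × r ≈ degNorm d x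

  QuotientRatios : ∀ d → Pred Carrier (c ⊔ ℓ₁ ⊔ ℓ₂)
  QuotientRatios d r = ∃ λ x → ¬ x ∈ₚ Im d ×
    ∃ λ m → IsDist d x m × IsQuotient ‖ δ d x ‖₁ m r

  IntegralRatios : ∀ d → Pred Carrier (c ⊔ ℓ₁ ⊔ ℓ₂)
  IntegralRatios d r = ∃ λ x → IsIntegral x × ¬ x ∈ₚ Im d ×
    ∃ λ m → IsDist d x m × IsQuotient ‖ δ d x ‖₁ m r

  OrthogonalRatios : ∀ d → Pred Carrier (c ⊔ ℓ₁ ⊔ ℓ₂)
  OrthogonalRatios d r = ∃ λ x → ¬ x ≋ 𝟎 × Perp¹ d x (Im d) ×
    IsQuotient ‖ δ d x ‖₁ (degNorm d x) r

  FillingRatios : ∀ d → Pred Carrier (c ⊔ ℓ₁ ⊔ ℓ₂)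
  FillingRatios d r = ∃ λ y → y ∈ₚ Im (suc d) × ¬ y ≋ 𝟎 ×
    ∃ λ m → IsFil d y m × IsQuotient ‖ y ‖₁ m r

  InverseFillingRatios : ∀ d → Pred Carrier (c ⊔ ℓ₁ ⊔ ℓ₂)
  InverseFillingRatios d r = ∃ λ y → y ∈ₚ Im (suc d) × ¬ y ≋ 𝟎 ×
    ∃ λ m → IsFil d y m × IsQuotient m ‖ y ‖₁ r

  IsCheegerConstant : ∀ d → Carrier → Set (c ⊔ ℓ₁ ⊔ ℓ₂)
  IsCheegerConstant d = IsInfimum (QuotientRatios d)

{-# OPTIONS --safe #-}

-- By the double description method, polyhedral cones are finitely generated, by
-- integral vectors if the inequalities are integral. Applied to the epigraph of
-- x ↦ ‖ A x ‖₁ this yields finitely many test points such that a sublinear g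
-- which is at most ‖ A x ‖₁ at these is so everywhere. Hence the distance to
-- Im d is attained, and, as h · dist is sublinear, the minimum h of the ratios
-- ‖ δ x ‖₁ / dist x over the (integral) test points of δ is the minimum over all x.
-- The Hahn–Banach theorem identifies the x with x ⊥¹ Im d as those of norm dist x.

module Submission where

open import Defs
open import Level using (Level; _⊔_)
open import Algebra.Solver.Ring.AlmostCommutativeRing using (fromCommutativeRing; _-Raw-AlmostCommutative⟶_)
open import Data.Bool.Base using (if_then_else_)
import Data.Bool.Properties as Bool
open import Data.Empty as Empty using (⊥-elim)
open import Data.Fin.Base as Fin using (Fin; zero; suc; _↑ˡ_; _↑ʳ_)
import Data.Fin.Properties as Fin
open import Data.Fin.Subset using (Subset; inside; outside; ∣_∣; Nonempty; _⊆_; _-_; ⊥)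
  renaming (_∈_ to _∈ₛ_; _∉_ to _∉ₛ_)
open import Data.Fin.Subset.Properties
  using (_∈?_; _⊆?_; p─⊥≡p; x∈p∧x≢y⇒x∈p-y; p─x─y≡p─y─x; p─q⊆p; drop-∷-⊆; p⊆q⇒∣p∣≤∣q∣; ∉⊥; ⊥⊆; ∣⊥∣≡0)
open import Data.Integer.Base as ℤ using (ℤ; +_; -[1+_])
import Data.Integer.Properties as ℤ
open import Data.List.Base as List
  using (List; []; _∷_; _++_; filter; length; lookup; allFin; cartesianProductWith; tabulate)
open import Data.List.Membership.Propositional using (_∈_)
open import Data.List.Membership.Propositional.Properties
  using (∈-++⁺ˡ; ∈-++⁺ʳ; ∈-++⁻; ∈-filter⁺; ∈-filter⁻; ∈-cartesianProductWith⁺; ∈-cartesianProductWith⁻;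
         ∈-tabulate⁺; ∈-tabulate⁻; ∈-map⁺; ∈-map⁻; ∈-lookup; ∈-allFin)
open import Data.List.Properties using (filter-accept; filter-reject; filter-none)
open import Data.List.Relation.Unary.All as All using (All; []; _∷_)
open import Data.List.Relation.Unary.AllPairs using ([]; _∷_)
open import Data.List.Relation.Unary.Any as Any using (here; there)
open import Data.List.Relation.Unary.Any.Properties using (lookup-index)
open import Data.List.Relation.Unary.Unique.Propositional using (Unique)
import Data.List.Relation.Unary.Unique.Propositional.Properties as Unique
open import Data.Maybe.Base as Maybe using ()
open import Data.Nat.Base as ℕ using (ℕ; zero; suc)
import Data.Nat.Properties as ℕ
open import Data.Product.Base using (∃; ∃₂; _×_; _,_; proj₁; proj₂)
open import Data.Sign.Base as Sign using (Sign)
import Data.Sign.Properties as Sign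
open import Data.Sum.Base using (_⊎_; inj₁; inj₂)
open import Data.Vec.Base using ([]; _∷_; here; there)
open import Data.Vec.Functional as Vector using (Vector)
import Data.Vec.Functional.Properties as Vector
import Data.Vec.Properties as Vec
open import Function.Base using (_∘_)
open import Function.Bundles using (_⇔_; mk⇔)
open import Relation.Binary.Bundles using (TotalOrder)
open import Relation.Binary.Definitions using (tri<; tri≈; tri>)
import Relation.Binary.PropositionalEquality as ≡
open ≡ using (_≡_; _≢_)
open import Relation.Binary.Structures using (IsDecTotalOrder)
open import Relation.Nullary using (¬_; Dec; yes; no; does; dec⇒maybe)
open import Relation.Nullary.Decidable using (_×-dec_; ¬?; dec-true; dec-false; decidable-stable)
open import Relation.Unary using (Pred; Decidable)

module OrderedField {c ℓ₁ ℓ₂ : Level} (ℝ : CompleteOrderedField c ℓ₁ ℓ₂) where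

  open CompleteOrderedField ℝ public hiding (zero)
  open import Algebra.Properties.Ring ring public
    using (-‿distribˡ-*; -‿distribʳ-*; -0#≈0#; -‿involutive)
  open import Algebra.Properties.AbelianGroup +-abelianGroup using ()
    renaming (⁻¹-∙-comm to -‿+-comm)
  open import Algebra.Properties.Semiring.Mult semiring using (×-homo-+)
  open IsDecTotalOrder isDecTotalOrder public using (_≟_; _≤?_; total)
    renaming (refl to ≤-refl; reflexive to ≤-reflexive; trans to ≤-trans; antisym to ≤-antisym)
  open TotalOrder totalOrder using (poset)
  open import Relation.Binary.Reasoning.PartialOrder poset public

  private
    shift : ∀ a b c → a + b ≈ (c + a) + (b + - c)
    shift a b c = sym (begin-equality
      (c + a) + (b + - c) ≈⟨ +-congʳ (+-comm c a) ⟩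
      (a + c) + (b + - c) ≈⟨ +-assoc a c _ ⟩
      a + (c + (b + - c)) ≈⟨ +-congˡ (+-congˡ (+-comm b _)) ⟩
      a + (c + (- c + b)) ≈⟨ +-congˡ (+-assoc c _ b) ⟨
      a + ((c + - c) + b) ≈⟨ +-congˡ (+-congʳ (-‿inverseʳ c)) ⟩
      a + (0# + b)        ≈⟨ +-congˡ (+-identityˡ b) ⟩
      a + b               ∎)

  fromℤ-⊖ : ∀ m n → fromℤ (m ℤ.⊖ n) ≈ fromℕ m + - fromℕ n
  fromℤ-⊖ m       zero    = begin-equality
    fromℤ (m ℤ.⊖ zero) ≡⟨⟩
    fromℕ m            ≈⟨ +-identityʳ _ ⟨
    fromℕ m + 0#       ≈⟨ +-congˡ -0#≈0# ⟨
    fromℕ m + - 0#     ∎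
  fromℤ-⊖ zero    (suc n) = sym (+-identityˡ _)
  fromℤ-⊖ (suc m) (suc n) = begin-equality
    fromℤ (suc m ℤ.⊖ suc n)               ≡⟨ ≡.cong fromℤ (ℤ.[1+m]⊖[1+n]≡m⊖n m n) ⟩
    fromℤ (m ℤ.⊖ n)                       ≈⟨ fromℤ-⊖ m n ⟩
    fromℕ m + - fromℕ n                   ≈⟨ shift _ _ 1# ⟩
    (1# + fromℕ m) + (- fromℕ n + - 1#)   ≈⟨ +-congˡ (+-comm _ _) ⟩
    (1# + fromℕ m) + (- 1# + - fromℕ n)   ≈⟨ +-congˡ (-‿+-comm _ _) ⟩
    fromℕ (suc m) + - fromℕ (suc n)       ∎

  fromℕ-+ : ∀ m n → fromℕ (m ℕ.+ n) ≈ fromℕ m + fromℕ n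
  fromℕ-+ = ×-homo-+ 1#

  fromℤ-neg : ∀ i → fromℤ (ℤ.- i) ≈ - fromℤ i
  fromℤ-neg (+ zero)  = sym -0#≈0#
  fromℤ-neg (+ suc n) = refl
  fromℤ-neg -[1+ n ]  = sym (-‿involutive _)

  fromℤ-+ : ∀ i j → fromℤ (i ℤ.+ j) ≈ fromℤ i + fromℤ j
  fromℤ-+ (+ m)      (+ n)      = fromℕ-+ m n
  fromℤ-+ (+ m)      (-[1+ n ]) = fromℤ-⊖ m (suc n)
  fromℤ-+ (-[1+ m ]) (+ n)      = trans (fromℤ-⊖ n (suc m)) (+-comm _ _)
  fromℤ-+ (-[1+ m ]) (-[1+ n ]) = begin-equality
    - (1# + (1# + fromℕ (m ℕ.+ n)))            ≈⟨ -‿cong (+-congˡ (+-congˡ (fromℕ-+ m n))) ⟩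
    - (1# + (1# + (fromℕ m + fromℕ n)))        ≈⟨ -‿cong (+-congˡ (+-assoc _ _ _)) ⟨
    - (1# + ((1# + fromℕ m) + fromℕ n))        ≈⟨ -‿cong (+-congˡ (+-comm _ _)) ⟩
    - (1# + (fromℕ n + (1# + fromℕ m)))        ≈⟨ -‿cong (+-assoc _ _ _) ⟨
    - ((1# + fromℕ n) + (1# + fromℕ m))        ≈⟨ -‿cong (+-comm _ _) ⟩
    - (fromℕ (suc m) + fromℕ (suc n))          ≈⟨ -‿+-comm _ _ ⟨
    - fromℕ (suc m) + - fromℕ (suc n)          ∎

  private
    fromℤ-*-+ : ∀ m j → fromℤ (+ m ℤ.* j) ≈ fromℕ m * fromℤ j
    fromℤ-*-+ zero j = trans (reflexive (≡.cong fromℤ (ℤ.*-zeroˡ j))) (sym (zeroˡ _))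
    fromℤ-*-+ (suc m) j = begin-equality
      fromℤ (+ suc m ℤ.* j)          ≡⟨ ≡.cong fromℤ (ℤ.suc-* (+ m) j) ⟩
      fromℤ (j ℤ.+ + m ℤ.* j)        ≈⟨ fromℤ-+ j (+ m ℤ.* j) ⟩
      fromℤ j + fromℤ (+ m ℤ.* j)    ≈⟨ +-cong (sym (*-identityˡ _)) (fromℤ-*-+ m j) ⟩
      1# * fromℤ j + fromℕ m * fromℤ j ≈⟨ distribʳ _ _ _ ⟨
      fromℕ (suc m) * fromℤ j        ∎

  fromℤ-* : ∀ i j → fromℤ (i ℤ.* j) ≈ fromℤ i * fromℤ j
  fromℤ-* (+ m)    j = fromℤ-*-+ m j
  fromℤ-* -[1+ m ] j = begin-equality
    fromℤ (ℤ.- (+ suc m) ℤ.* j)   ≡⟨ ≡.cong fromℤ (ℤ.neg-distribˡ-* (+ suc m) j) ⟨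
    fromℤ (ℤ.- (+ suc m ℤ.* j))   ≈⟨ fromℤ-neg (+ suc m ℤ.* j) ⟩
    - fromℤ (+ suc m ℤ.* j)       ≈⟨ -‿cong (fromℤ-*-+ (suc m) j) ⟩
    - (fromℕ (suc m) * fromℤ j)   ≈⟨ -‿distribˡ-* _ _ ⟩
    fromℤ -[1+ m ] * fromℤ j      ∎

  private
    morphism : ℤ.+-*-rawRing -Raw-AlmostCommutative⟶ fromCommutativeRing commutativeRing
    morphism = record
      { ⟦_⟧    = fromℤ
      ; +-homo = fromℤ-+
      ; *-homo = fromℤ-*
      ; -‿homo = fromℤ-neg
      ; 0-homo = refl
      ; 1-homo = +-identityʳ 1#
      }

  -- Integer coefficients make cancellation in the solver decidable.
  open import Algebra.Solver.Ring ℤ.+-*-rawRing (fromCommutativeRing commutativeRing) morphism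
    (λ i j → Maybe.map (λ eq → reflexive (≡.cong fromℤ eq)) (dec⇒maybe (i ℤ.≟ j))) public
    using (solve; _:=_; _:+_; _:*_; :-_; _:-_; con)

  -- Order

  infix 4 _<_

  _<_ : Carrier → Carrier → Set ℓ₂
  x < y = ¬ y ≤ x

  ≰⇒≥ : ∀ {x y} → ¬ x ≤ y → y ≤ x
  ≰⇒≥ {x} {y} x≰y with total x y
  ... | inj₁ x≤y = ⊥-elim (x≰y x≤y)
  ... | inj₂ y≤x = y≤x

  <⇒≉ : ∀ {x y} → x < y → ¬ y ≈ x
  <⇒≉ x<y y≈x = x<y (≤-reflexive y≈x)

  ≤∧≉⇒< : ∀ {x y} → x ≤ y → ¬ y ≈ x → x < y
  ≤∧≉⇒< x≤y y≉x y≤x = y≉x (≤-antisym y≤x x≤y)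

  ≤-resp-≈ : ∀ {x x′ y y′} → x ≈ x′ → y ≈ y′ → x ≤ y → x′ ≤ y′
  ≤-resp-≈ x≈x′ y≈y′ x≤y = ≤-trans (≤-reflexive (sym x≈x′)) (≤-trans x≤y (≤-reflexive y≈y′))

  +-mono-≤ : ∀ {x x′ y y′} → x ≤ x′ → y ≤ y′ → x + y ≤ x′ + y′
  +-mono-≤ {x} {x′} {y} {y′} x≤x′ y≤y′ = begin
    x + y   ≤⟨ +-monoˡ-≤ y x≤x′ ⟩
    x′ + y  ≈⟨ +-comm _ _ ⟩
    y + x′  ≤⟨ +-monoˡ-≤ x′ y≤y′ ⟩
    y′ + x′ ≈⟨ +-comm _ _ ⟩
    x′ + y′ ∎

  +-nonNegative : ∀ {x y} → 0# ≤ x → 0# ≤ y → 0# ≤ x + y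
  +-nonNegative 0≤x 0≤y = ≤-trans (≤-reflexive (sym (+-identityˡ 0#))) (+-mono-≤ 0≤x 0≤y)

  x≤y⇒0≤y-x : ∀ {x y} → x ≤ y → 0# ≤ y + - x
  x≤y⇒0≤y-x {x} x≤y = ≤-trans (≤-reflexive (sym (-‿inverseʳ x))) (+-monoˡ-≤ (- x) x≤y)

  0≤y-x⇒x≤y : ∀ {x y} → 0# ≤ y + - x → x ≤ y
  0≤y-x⇒x≤y {x} {y} 0≤y-x = begin
    x             ≈⟨ +-identityˡ x ⟨
    0# + x        ≤⟨ +-monoˡ-≤ x 0≤y-x ⟩
    y + - x + x   ≈⟨ solve 2 (λ x y → y :- x :+ x := y) refl x y ⟩
    y             ∎

  -‿antimono-≤ : ∀ {x y} → x ≤ y → - y ≤ - x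
  -‿antimono-≤ {x} {y} x≤y = 0≤y-x⇒x≤y (≤-trans (x≤y⇒0≤y-x x≤y) (≤-reflexive
    (solve 2 (λ x y → y :- x := (:- x) :- (:- y)) refl x y)))

  x≤0⇒0≤-x : ∀ {x} → x ≤ 0# → 0# ≤ - x
  x≤0⇒0≤-x x≤0 = ≤-trans (≤-reflexive (sym -0#≈0#)) (-‿antimono-≤ x≤0)

  *-monoˡ-≤ : ∀ {k x y} → 0# ≤ k → x ≤ y → k * x ≤ k * y
  *-monoˡ-≤ {k} {x} {y} 0≤k x≤y = 0≤y-x⇒x≤y (≤-trans (*-nonNegative 0≤k (x≤y⇒0≤y-x x≤y))
    (≤-reflexive (solve 3 (λ k x y → k :* (y :- x) := k :* y :- k :* x) refl k x y)))

  0≤1 : 0# ≤ 1#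
  0≤1 with total 0# 1#
  ... | inj₁ 0≤1 = 0≤1
  ... | inj₂ 1≤0 = begin
    0#                ≤⟨ *-nonNegative (x≤0⇒0≤-x 1≤0) (x≤0⇒0≤-x 1≤0) ⟩
    - 1# * - 1#       ≈⟨ solve 1 (λ x → (:- x) :* (:- x) := x :* x) refl 1# ⟩
    1# * 1#           ≈⟨ *-identityʳ 1# ⟩
    1#                ∎

  0<1 : 0# < 1#
  0<1 1≤0 = 0≉1 (≤-antisym 0≤1 1≤0)

  x≤x+y : ∀ {x y} → 0# ≤ y → x ≤ x + y
  x≤x+y {x} {y} 0≤y = ≤-resp-≈ (+-identityʳ x) refl (+-mono-≤ ≤-refl 0≤y)

  fromℕ-nonNegative : ∀ k → 0# ≤ fromℕ k
  fromℕ-nonNegative zero    = ≤-refl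
  fromℕ-nonNegative (suc k) = +-nonNegative 0≤1 (fromℕ-nonNegative k)

  fromℕ-positive : ∀ {k} → 0 ℕ.< k → 0# < fromℕ k
  fromℕ-positive {suc k} _ 1+k≤0 = 0<1 (≤-trans (x≤x+y (fromℕ-nonNegative k)) 1+k≤0)

  x+x≈0⇒x≈0 : ∀ {x} → x + x ≈ 0# → x ≈ 0#
  x+x≈0⇒x≈0 {x} 2x≈0 with total 0# x
  ... | inj₁ 0≤x = ≤-antisym (≤-trans (x≤x+y 0≤x) (≤-reflexive 2x≈0)) 0≤x
  ... | inj₂ x≤0 = ≤-antisym x≤0 (≤-trans (≤-reflexive (sym 2x≈0))
                     (≤-resp-≈ refl (+-identityʳ x) (+-mono-≤ ≤-refl x≤0)))

  *-cancelˡ-≈0 : ∀ {k x} → ¬ k ≈ 0# → k * x ≈ 0# → x ≈ 0#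
  *-cancelˡ-≈0 {k} {x} k≉0 kx≈0 with inverse k k≉0
  ... | k⁻¹ , kk⁻¹≈1 = begin-equality
    x              ≈⟨ *-identityˡ x ⟨
    1# * x         ≈⟨ *-congʳ kk⁻¹≈1 ⟨
    k * k⁻¹ * x    ≈⟨ solve 3 (λ k i x → k :* i :* x := i :* (k :* x)) refl k k⁻¹ x ⟩
    k⁻¹ * (k * x)  ≈⟨ *-congˡ kx≈0 ⟩
    k⁻¹ * 0#       ≈⟨ zeroʳ _ ⟩
    0#             ∎

  inverse-positive : ∀ {x} → 0# < x → ∃ λ y → x * y ≈ 1# × 0# ≤ y
  inverse-positive {x} 0<x with inverse x (<⇒≉ 0<x)
  ... | y , xy≈1 with total 0# y
  ... | inj₁ 0≤y = y , xy≈1 , 0≤y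
  ... | inj₂ y≤0 = ⊥-elim (0<1 (≤-resp-≈ xy≈1 (zeroʳ x) (*-monoˡ-≤ (≰⇒≥ 0<x) y≤0)))

  *-cancelˡ-≤ : ∀ {k x y} → 0# < k → k * x ≤ k * y → x ≤ y
  *-cancelˡ-≤ {k} {x} {y} 0<k kx≤ky with inverse-positive 0<k
  ... | k⁻¹ , kk⁻¹≈1 , 0≤k⁻¹ = ≤-resp-≈ (cancel x) (cancel y) (*-monoˡ-≤ 0≤k⁻¹ kx≤ky)
    where
    cancel : ∀ z → k⁻¹ * (k * z) ≈ z
    cancel z = begin-equality
      k⁻¹ * (k * z)  ≈⟨ solve 3 (λ k i x → i :* (k :* x) := k :* i :* x) refl k k⁻¹ z ⟩
      k * k⁻¹ * z    ≈⟨ *-congʳ kk⁻¹≈1 ⟩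
      1# * z         ≈⟨ *-identityˡ z ⟩
      z              ∎

  -- Absolute value

  open import Algebra.Construct.NaturalChoice.Max totalOrder using (x≤x⊔y; x≤y⊔x; ⊔-cong; ⊔-lub)

  abs-cong : ∀ {x y} → x ≈ y → abs x ≈ abs y
  abs-cong x≈y = ⊔-cong x≈y (-‿cong x≈y)

  x≤abs : ∀ x → x ≤ abs x
  x≤abs x = x≤x⊔y x (- x)

  -x≤abs : ∀ x → - x ≤ abs x
  -x≤abs x = x≤y⊔x x (- x)

  abs-lub : ∀ {x y} → x ≤ y → - x ≤ y → abs x ≤ y
  abs-lub = ⊔-lub

  abs-nonNegative : ∀ x → 0# ≤ abs x
  abs-nonNegative x with total 0# x
  ... | inj₁ 0≤x = ≤-trans 0≤x (x≤abs x)
  ... | inj₂ x≤0 = ≤-trans (x≤0⇒0≤-x x≤0) (-x≤abs x)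

  abs-subadditive : ∀ x y → abs (x + y) ≤ abs x + abs y
  abs-subadditive x y = abs-lub (+-mono-≤ (x≤abs x) (x≤abs y))
    (≤-trans (≤-reflexive (sym (-‿+-comm x y))) (+-mono-≤ (-x≤abs x) (-x≤abs y)))

  abs-scale : ∀ {k} x → 0# ≤ k → abs (k * x) ≤ k * abs x
  abs-scale {k} x 0≤k = abs-lub (*-monoˡ-≤ 0≤k (x≤abs x))
    (≤-trans (≤-reflexive (-‿distribʳ-* k x)) (*-monoˡ-≤ 0≤k (-x≤abs x)))

  abs-zero : abs 0# ≈ 0#
  abs-zero = ≤-antisym (abs-lub ≤-refl (≤-reflexive -0#≈0#)) (abs-nonNegative 0#)

  abs≈0⇒≈0 : ∀ {x} → abs x ≈ 0# → x ≈ 0#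
  abs≈0⇒≈0 {x} abs≈0 = ≤-antisym (≤-trans (x≤abs x) (≤-reflexive abs≈0))
    (≤-trans (x≤0⇒0≤-x (≤-trans (-x≤abs x) (≤-reflexive abs≈0))) (≤-reflexive (-‿involutive x)))

module LinearAlgebra {c ℓ₁ ℓ₂ : Level} (ℝ : CompleteOrderedField c ℓ₁ ℓ₂) where

  open OrderedField ℝ
  open import Algebra.Properties.Semiring.Sum semiring public
    using (sum-cong-≋; ∑-distrib-+; *-distribˡ-sum; sum-replicate-zero)

  sum-mono : ∀ {k} {x y : Vector Carrier k} → (∀ i → x i ≤ y i) → sum x ≤ sum y
  sum-mono {zero}  x≤y = ≤-refl
  sum-mono {suc k} x≤y = +-mono-≤ (x≤y zero) (sum-mono (λ i → x≤y (suc i)))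

  sum-zero : ∀ {k} {x : Vector Carrier k} → (∀ i → x i ≈ 0#) → sum x ≈ 0#
  sum-zero {k} x≈0 = trans (sum-cong-≋ x≈0) (sum-replicate-zero k)

  sum-nonNegative : ∀ {k} {x : Vector Carrier k} → (∀ i → 0# ≤ x i) → 0# ≤ sum x
  sum-nonNegative {zero}  0≤x = ≤-refl
  sum-nonNegative {suc k} 0≤x = +-nonNegative (0≤x zero) (sum-nonNegative (λ i → 0≤x (suc i)))

  infix  4 _≋_
  infixl 6 _⊕_
  infixr 7 _⊛_

  _≋_ : ∀ {k} → Vector Carrier k → Vector Carrier k → Set ℓ₁
  x ≋ y = ∀ i → x i ≈ y i

  𝟎 : ∀ {k} → Vector Carrier k
  𝟎 _ = 0#

  _⊕_ : ∀ {k} → Vector Carrier k → Vector Carrier k → Vector Carrier k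
  (x ⊕ y) i = x i + y i

  _⊛_ : ∀ {k} → Carrier → Vector Carrier k → Vector Carrier k
  (a ⊛ x) i = a * x i

  ⊖_ : ∀ {k} → Vector Carrier k → Vector Carrier k
  (⊖ x) i = - x i

  basis : ∀ {k} → Fin k → Vector Carrier k
  basis zero    zero    = 1#
  basis zero    (suc j) = 0#
  basis (suc i) zero    = 0#
  basis (suc i) (suc j) = basis i j

  ⟨_,_⟩ : ∀ {k} → Vector Carrier k → Vector Carrier k → Carrier
  ⟨ x , y ⟩ = sum λ i → x i * y i

  ⟨⟩-congʳ : ∀ {k} (a : Vector Carrier k) {x y} → x ≋ y → ⟨ a , x ⟩ ≈ ⟨ a , y ⟩
  ⟨⟩-congʳ a x≋y = sum-cong-≋ (λ i → *-congˡ (x≋y i))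

  ⟨⟩-⊕ʳ : ∀ {k} (a x y : Vector Carrier k) → ⟨ a , x ⊕ y ⟩ ≈ ⟨ a , x ⟩ + ⟨ a , y ⟩
  ⟨⟩-⊕ʳ a x y = trans (sum-cong-≋ (λ i → distribˡ (a i) (x i) (y i)))
    (∑-distrib-+ (λ i → a i * x i) (λ i → a i * y i))

  ⟨⟩-⊛ʳ : ∀ {k} (a : Vector Carrier k) b x → ⟨ a , b ⊛ x ⟩ ≈ b * ⟨ a , x ⟩
  ⟨⟩-⊛ʳ a b x = trans
    (sum-cong-≋ (λ i → solve 3 (λ a b x → a :* (b :* x) := b :* (a :* x)) refl (a i) b (x i)))
    (sym (*-distribˡ-sum b (λ i → a i * x i)))

  ⟨⟩-𝟎ʳ : ∀ {k} (a : Vector Carrier k) → ⟨ a , 𝟎 ⟩ ≈ 0#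
  ⟨⟩-𝟎ʳ a = sum-zero (λ i → zeroʳ (a i))

  ⟨⟩-comm : ∀ {k} (a x : Vector Carrier k) → ⟨ a , x ⟩ ≈ ⟨ x , a ⟩
  ⟨⟩-comm a x = sum-cong-≋ (λ i → *-comm (a i) (x i))

  ⟨⟩-⊖ˡ : ∀ {k} (a x : Vector Carrier k) → ⟨ ⊖ a , x ⟩ ≈ - ⟨ a , x ⟩
  ⟨⟩-⊖ˡ a x = begin-equality
    ⟨ ⊖ a , x ⟩
      ≈⟨ sum-cong-≋ (λ i → solve 2 (λ a x → (:- a) :* x := (:- con (+ 1)) :* (x :* a)) refl (a i) (x i)) ⟩
    ⟨ (λ _ → - fromℕ 1) , (λ i → x i * a i) ⟩ ≈⟨ *-distribˡ-sum _ (λ i → x i * a i) ⟨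
    - fromℕ 1 * ⟨ x , a ⟩   ≈⟨ *-congˡ (⟨⟩-comm x a) ⟩
    - fromℕ 1 * ⟨ a , x ⟩   ≈⟨ solve 1 (λ x → (:- con (+ 1)) :* x := :- x) refl _ ⟩
    - ⟨ a , x ⟩             ∎

  ⟨⟩-⊖ʳ : ∀ {k} (a x : Vector Carrier k) → ⟨ a , ⊖ x ⟩ ≈ - ⟨ a , x ⟩
  ⟨⟩-⊖ʳ a x = trans (⟨⟩-comm a (⊖ x)) (trans (⟨⟩-⊖ˡ x a) (-‿cong (⟨⟩-comm x a)))

  ⟨⟩-basisʳ : ∀ {k} (a : Vector Carrier k) i → ⟨ a , basis i ⟩ ≈ a i
  ⟨⟩-basisʳ a zero    = trans (+-cong (*-identityʳ _) (⟨⟩-𝟎ʳ (a ∘ suc))) (+-identityʳ _)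
  ⟨⟩-basisʳ a (suc i) = trans (+-cong (zeroʳ _) (⟨⟩-basisʳ (a ∘ suc) i)) (+-identityˡ _)

  basis-sym : ∀ {k} (i j : Fin k) → basis i j ≡ basis j i
  basis-sym zero    zero    = ≡.refl
  basis-sym zero    (suc j) = ≡.refl
  basis-sym (suc i) zero    = ≡.refl
  basis-sym (suc i) (suc j) = basis-sym i j

  ⟨⟩-split : ∀ m {n} (a x : Vector Carrier (m ℕ.+ n)) →
             ⟨ a , x ⟩ ≈ ⟨ Vector.take m a , Vector.take m x ⟩ + ⟨ Vector.drop m a , Vector.drop m x ⟩
  ⟨⟩-split zero    a x = sym (+-identityˡ _)
  ⟨⟩-split (suc m) a x = trans (+-congˡ (⟨⟩-split m (a ∘ suc) (x ∘ suc))) (sym (+-assoc _ _ _))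

  ⟨⟩-++ˡ : ∀ {m n} (a : Vector Carrier m) (b : Vector Carrier n) x →
           ⟨ a Vector.++ b , x ⟩ ≈ ⟨ a , Vector.take m x ⟩ + ⟨ b , Vector.drop m x ⟩
  ⟨⟩-++ˡ {m} a b x = trans (⟨⟩-split m (a Vector.++ b) x) (+-cong
    (sum-cong-≋ (λ i → *-congʳ (reflexive (Vector.lookup-++ˡ a b i))))
    (sum-cong-≋ (λ i → *-congʳ (reflexive (Vector.lookup-++ʳ a b i)))))

  combination : ∀ {k m} → Vector (Vector Carrier k) m → Vector Carrier m → Vector Carrier k
  combination v s j = sum λ i → s i * v i j

  combination-basis : ∀ {k} (s : Vector Carrier k) → combination basis s ≋ s
  combination-basis s j = trans
    (sum-cong-≋ (λ i → *-congˡ (reflexive (basis-sym i j)))) (⟨⟩-basisʳ s j)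

  -- Sublinear functions

  record IsSublinear {k} (g : Vector Carrier k → Carrier) : Set (c ⊔ ℓ₁ ⊔ ℓ₂) where
    field
      resp-≋      : ∀ {x y} → x ≋ y → g x ≤ g y
      subadditive : ∀ x y → g (x ⊕ y) ≤ g x + g y
      homogeneous : ∀ {b} x → 0# ≤ b → g (b ⊛ x) ≤ b * g x

    zero-≤ : g 𝟎 ≤ 0#
    zero-≤ = begin
      g 𝟎         ≤⟨ resp-≋ (λ _ → sym (zeroˡ 0#)) ⟩
      g (0# ⊛ 𝟎)  ≤⟨ homogeneous 𝟎 ≤-refl ⟩
      0# * g 𝟎    ≈⟨ zeroˡ _ ⟩
      0#          ∎

  weightedNorm : ∀ {k} → Vector Carrier k → Vector Carrier k → Carrier
  weightedNorm w x = sum λ i → w i * abs (x i)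

  module _ {k} {w : Vector Carrier k} (0≤w : ∀ i → 0# ≤ w i) where

    weightedNorm-isSublinear : IsSublinear (weightedNorm w)
    weightedNorm-isSublinear = record
      { resp-≋      = λ x≋y → ≤-reflexive (sum-cong-≋ (λ i → *-congˡ (abs-cong (x≋y i))))
      ; subadditive = λ x y → begin
          weightedNorm w (x ⊕ y)
            ≤⟨ sum-mono (λ i → *-monoˡ-≤ (0≤w i) (abs-subadditive (x i) (y i))) ⟩
          sum (λ i → w i * (abs (x i) + abs (y i)))
            ≈⟨ sum-cong-≋ (λ i → distribˡ (w i) (abs (x i)) (abs (y i))) ⟩
          sum (λ i → w i * abs (x i) + w i * abs (y i))
            ≈⟨ ∑-distrib-+ (λ i → w i * abs (x i)) (λ i → w i * abs (y i)) ⟩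
          weightedNorm w x + weightedNorm w y ∎
      ; homogeneous = λ {b} x 0≤b → begin
          weightedNorm w (b ⊛ x)
            ≤⟨ sum-mono (λ i → *-monoˡ-≤ (0≤w i) (abs-scale (x i) 0≤b)) ⟩
          ⟨ w , b ⊛ (λ i → abs (x i)) ⟩
            ≈⟨ ⟨⟩-⊛ʳ w b (λ i → abs (x i)) ⟩
          b * weightedNorm w x ∎
      }

    weightedNorm-nonNegative : ∀ x → 0# ≤ weightedNorm w x
    weightedNorm-nonNegative x = sum-nonNegative (λ i → *-nonNegative (0≤w i) (abs-nonNegative (x i)))

  sum≈0⇒≈0 : ∀ {k} {x : Vector Carrier k} → (∀ i → 0# ≤ x i) → sum x ≈ 0# → ∀ i → x i ≈ 0#
  sum≈0⇒≈0 {suc k} {x} 0≤x ∑≈0 = λ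
    { zero    → head≈0
    ; (suc i) → sum≈0⇒≈0 (0≤x ∘ suc) (trans (sym (trans (+-congʳ head≈0) (+-identityˡ _))) ∑≈0) i }
    where
    head≈0 : x zero ≈ 0#
    head≈0 = ≤-antisym (≤-trans (x≤x+y (sum-nonNegative (0≤x ∘ suc))) (≤-reflexive ∑≈0)) (0≤x zero)

  weightedNorm≈0⇒≋𝟎 : ∀ {k} {w : Vector Carrier k} → (∀ i → 0# < w i) →
                       ∀ {x} → weightedNorm w x ≈ 0# → x ≋ 𝟎
  weightedNorm≈0⇒≋𝟎 0<w {x} norm≈0 i = abs≈0⇒≈0 (*-cancelˡ-≈0 (<⇒≉ (0<w i))
    (sum≈0⇒≈0 (λ i → *-nonNegative (≰⇒≥ (0<w i)) (abs-nonNegative (x i))) norm≈0 i))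

  -- Integral vectors

  IsInteger : Carrier → Set ℓ₁
  IsInteger x = ∃ λ i → x ≈ fromℤ i

  IsIntegral : ∀ {k} → Vector Carrier k → Set ℓ₁
  IsIntegral x = ∀ i → IsInteger (x i)

  integer-0 : IsInteger 0#
  integer-0 = + 0 , refl

  integer-1 : IsInteger 1#
  integer-1 = + 1 , sym (+-identityʳ 1#)

  integer-+ : ∀ {x y} → IsInteger x → IsInteger y → IsInteger (x + y)
  integer-+ (i , x≈i) (j , y≈j) = i ℤ.+ j , trans (+-cong x≈i y≈j) (sym (fromℤ-+ i j))

  integer-* : ∀ {x y} → IsInteger x → IsInteger y → IsInteger (x * y)
  integer-* (i , x≈i) (j , y≈j) = i ℤ.* j , trans (*-cong x≈i y≈j) (sym (fromℤ-* i j))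

  integer-neg : ∀ {x} → IsInteger x → IsInteger (- x)
  integer-neg (i , x≈i) = ℤ.- i , trans (-‿cong x≈i) (sym (fromℤ-neg i))

  integer-sum : ∀ {k} {x : Vector Carrier k} → IsIntegral x → IsInteger (sum x)
  integer-sum {zero}  _ = integer-0
  integer-sum {suc k} h = integer-+ (h zero) (integer-sum (h ∘ suc))

  integer-⟨⟩ : ∀ {k} {a x : Vector Carrier k} → IsIntegral a → IsIntegral x → IsInteger ⟨ a , x ⟩
  integer-⟨⟩ ha hx = integer-sum (λ i → integer-* (ha i) (hx i))

  integral-basis : ∀ {k} (i : Fin k) → IsIntegral (basis i)
  integral-basis zero    zero    = integer-1
  integral-basis zero    (suc j) = integer-0
  integral-basis (suc i) zero    = integer-0
  integral-basis (suc i) (suc j) = integral-basis i j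

  integral-++ : ∀ {m n} {x : Vector Carrier m} {y : Vector Carrier n} →
                IsIntegral x → IsIntegral y → IsIntegral (x Vector.++ y)
  integral-++ {m} hx hy i with Fin.splitAt m i
  ... | inj₁ j = hx j
  ... | inj₂ j = hy j

  -- Finitely generated cones

  data Cone {k} (R : List (Vector Carrier k)) : Vector Carrier k → Set (c ⊔ ℓ₁ ⊔ ℓ₂) where
    generator : ∀ {r} → r ∈ R → Cone R r
    zero      : Cone R 𝟎
    add       : ∀ {x y} → Cone R x → Cone R y → Cone R (x ⊕ y)
    scale     : ∀ {b x} → 0# ≤ b → Cone R x → Cone R (b ⊛ x)
    resp      : ∀ {x y} → x ≋ y → Cone R x → Cone R y

  record IsLinear {k m} (f : Vector Carrier k → Vector Carrier m) : Set (c ⊔ ℓ₁) where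
    field
      f-cong : ∀ {x y} → x ≋ y → f x ≋ f y
      f-⊕    : ∀ x y → f (x ⊕ y) ≋ f x ⊕ f y
      f-⊛    : ∀ b x → f (b ⊛ x) ≋ b ⊛ f x

  cone-map : ∀ {k m} {f : Vector Carrier k → Vector Carrier m} → IsLinear f →
             ∀ {R S} → (∀ {r} → r ∈ R → Cone S (f r)) → ∀ {x} → Cone R x → Cone S (f x)
  cone-map {f = f} lin f[R] = go
    where
    open IsLinear lin
    go : ∀ {x} → Cone _ x → Cone _ (f x)
    go (generator r∈R) = f[R] r∈R
    go zero            = resp (λ i → trans (sym (zeroˡ _))
      (trans (sym (f-⊛ 0# 𝟎 i)) (f-cong (λ _ → zeroˡ 0#) i))) zero
    go (add p q)       = resp (λ i → sym (f-⊕ _ _ i)) (add (go p) (go q))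
    go (scale 0≤b p)   = resp (λ i → sym (f-⊛ _ _ i)) (scale 0≤b (go p))
    go (resp x≋y p)    = resp (f-cong x≋y) (go p)

  cone-mono : ∀ {k} {R S : List (Vector Carrier k)} → (∀ {r} → r ∈ R → r ∈ S) → ∀ {x} → Cone R x → Cone S x
  cone-mono R⊆S = cone-map {f = λ x → x}
    record { f-cong = λ x≋y → x≋y ; f-⊕ = λ _ _ _ → refl ; f-⊛ = λ _ _ _ → refl }
    (λ r∈R → generator (R⊆S r∈R))

  module _ {k} (a : Vector Carrier k) where

    -- For ⟨ a , x ⟩ ≥ 0 ≥ ⟨ a , y ⟩ this is a point of the cone spanned by x and
    -- y on the hyperplane orthogonal to a.
    eliminate : Vector Carrier k → Vector Carrier k → Vector Carrier k
    eliminate x y = ⟨ a , x ⟩ ⊛ y ⊕ (- ⟨ a , y ⟩) ⊛ x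

    eliminate-linearʳ : ∀ x → IsLinear (eliminate x)
    eliminate-linearʳ x = record
      { f-cong = λ y≋z i → +-cong (*-congˡ (y≋z i)) (*-congʳ (-‿cong (⟨⟩-congʳ a y≋z)))
      ; f-⊕    = λ y z i → trans (+-congˡ (*-congʳ (-‿cong (⟨⟩-⊕ʳ a y z))))
          (solve 6 (λ ax x y z ay az → ax :* (y :+ z) :+ (:- (ay :+ az)) :* x
                      := (ax :* y :+ (:- ay) :* x) :+ (ax :* z :+ (:- az) :* x))
                 refl ⟨ a , x ⟩ (x i) (y i) (z i) ⟨ a , y ⟩ ⟨ a , z ⟩)
      ; f-⊛    = λ b y i → trans (+-congˡ (*-congʳ (-‿cong (⟨⟩-⊛ʳ a b y))))
          (solve 5 (λ ax x y b ay → ax :* (b :* y) :+ (:- (b :* ay)) :* x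
                      := b :* (ax :* y :+ (:- ay) :* x))
                 refl ⟨ a , x ⟩ (x i) (y i) b ⟨ a , y ⟩)
      }

    eliminate-linearˡ : ∀ z → IsLinear (λ x → eliminate x z)
    eliminate-linearˡ z = record
      { f-cong = λ x≋y i → +-cong (*-congʳ (⟨⟩-congʳ a x≋y)) (*-congˡ (x≋y i))
      ; f-⊕    = λ x y i → trans (+-congʳ (*-congʳ (⟨⟩-⊕ʳ a x y)))
          (solve 6 (λ ax ay az x y z → (ax :+ ay) :* z :+ (:- az) :* (x :+ y)
                      := (ax :* z :+ (:- az) :* x) :+ (ay :* z :+ (:- az) :* y))
                 refl ⟨ a , x ⟩ ⟨ a , y ⟩ ⟨ a , z ⟩ (x i) (y i) (z i))
      ; f-⊛    = λ b x i → trans (+-congʳ (*-congʳ (⟨⟩-⊛ʳ a b x)))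
          (solve 5 (λ ax az x z b → (b :* ax) :* z :+ (:- az) :* (b :* x)
                      := b :* (ax :* z :+ (:- az) :* x))
                 refl ⟨ a , x ⟩ ⟨ a , z ⟩ (x i) (z i) b)
      }

    ⟨⟩-eliminate : ∀ b x y → ⟨ b , eliminate x y ⟩ ≈ ⟨ a , x ⟩ * ⟨ b , y ⟩ + - ⟨ a , y ⟩ * ⟨ b , x ⟩
    ⟨⟩-eliminate b x y =
      trans (⟨⟩-⊕ʳ b (⟨ a , x ⟩ ⊛ y) ((- ⟨ a , y ⟩) ⊛ x)) (+-cong (⟨⟩-⊛ʳ b ⟨ a , x ⟩ y) (⟨⟩-⊛ʳ b (- ⟨ a , y ⟩) x))

    private
      nonNegative? : ∀ x → Dec (0# ≤ ⟨ a , x ⟩)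
      nonNegative? x = 0# ≤? ⟨ a , x ⟩

    upper lower cut : List (Vector Carrier k) → List (Vector Carrier k)
    upper R = filter nonNegative? R
    lower R = filter (λ x → ¬? (nonNegative? x)) R
    cut R   = upper R ++ cartesianProductWith eliminate (upper R) (lower R)

    cut-sound : ∀ R {r} → r ∈ cut R →
                0# ≤ ⟨ a , r ⟩ × (∀ b → (∀ {s} → s ∈ R → 0# ≤ ⟨ b , s ⟩) → 0# ≤ ⟨ b , r ⟩)
    cut-sound R r∈ with ∈-++⁻ (upper R) r∈
    ... | inj₁ r∈upper with ∈-filter⁻ nonNegative? {xs = R} r∈upper
    ... | r∈R , 0≤ar = 0≤ar , λ b hb → hb r∈R
    cut-sound R r∈ | inj₂ r∈prod with ∈-cartesianProductWith⁻ eliminate (upper R) (lower R) r∈prod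
    ... | x , y , x∈ , y∈ , ≡.refl
      with ∈-filter⁻ nonNegative? {xs = R} x∈ | ∈-filter⁻ (λ x → ¬? (nonNegative? x)) {xs = R} y∈
    ... | x∈R , 0≤ax | y∈R , ay<0
      = ≤-trans (≤-reflexive (solve 2 (λ x y → con (+ 0) := x :* y :+ (:- y) :* x) refl ⟨ a , x ⟩ ⟨ a , y ⟩))
                (≤-reflexive (sym (⟨⟩-eliminate a x y)))
      , λ b hb → ≤-trans (+-nonNegative (*-nonNegative 0≤ax (hb y∈R)) (*-nonNegative (x≤0⇒0≤-x (≰⇒≥ ay<0)) (hb x∈R)))
                (≤-reflexive (sym (⟨⟩-eliminate b x y)))

    private
      upper-⟨⟩ : ∀ R {x} → Cone (upper R) x → 0# ≤ ⟨ a , x ⟩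
      upper-⟨⟩ R (generator r∈)  = proj₂ (∈-filter⁻ nonNegative? {xs = R} r∈)
      upper-⟨⟩ R zero            = ≤-reflexive (sym (⟨⟩-𝟎ʳ a))
      upper-⟨⟩ R (add p q)       =
        ≤-trans (+-nonNegative (upper-⟨⟩ R p) (upper-⟨⟩ R q)) (≤-reflexive (sym (⟨⟩-⊕ʳ a _ _)))
      upper-⟨⟩ R (scale 0≤b p)   =
        ≤-trans (*-nonNegative 0≤b (upper-⟨⟩ R p)) (≤-reflexive (sym (⟨⟩-⊛ʳ a _ _)))
      upper-⟨⟩ R (resp x≋y p)    = ≤-trans (upper-⟨⟩ R p) (≤-reflexive (⟨⟩-congʳ a x≋y))

      lower-⟨⟩ : ∀ R {x} → Cone (lower R) x → ⟨ a , x ⟩ < 0# ⊎ x ≋ 𝟎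
      lower-⟨⟩ R (generator r∈)  = inj₁ (proj₂ (∈-filter⁻ (λ x → ¬? (nonNegative? x)) {xs = R} r∈))
      lower-⟨⟩ R zero            = inj₂ (λ _ → refl)
      lower-⟨⟩ R (add {x} {y} p q) with lower-⟨⟩ R p | lower-⟨⟩ R q
      ... | inj₁ ax<0 | inj₁ ay<0 = inj₁ λ 0≤a → ax<0 (begin
        0#                      ≤⟨ 0≤a ⟩
        ⟨ a , x ⊕ y ⟩           ≈⟨ ⟨⟩-⊕ʳ a x y ⟩
        ⟨ a , x ⟩ + ⟨ a , y ⟩   ≤⟨ +-mono-≤ ≤-refl (≰⇒≥ ay<0) ⟩
        ⟨ a , x ⟩ + 0#          ≈⟨ +-identityʳ _ ⟩
        ⟨ a , x ⟩               ∎)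
      ... | inj₁ ax<0 | inj₂ y≋0  =
        inj₁ λ 0≤a → ax<0 (≤-trans 0≤a (≤-reflexive (⟨⟩-congʳ a (λ i → trans (+-congˡ (y≋0 i)) (+-identityʳ _)))))
      ... | inj₂ x≋0  | inj₁ ay<0 =
        inj₁ λ 0≤a → ay<0 (≤-trans 0≤a (≤-reflexive (⟨⟩-congʳ a (λ i → trans (+-congʳ (x≋0 i)) (+-identityˡ _)))))
      ... | inj₂ x≋0  | inj₂ y≋0  = inj₂ λ i → trans (+-cong (x≋0 i) (y≋0 i)) (+-identityʳ _)
      lower-⟨⟩ R (scale {b} {x} 0≤b p) with lower-⟨⟩ R p | b ≟ 0#
      ... | inj₂ x≋0  | _       = inj₂ λ i → trans (*-congˡ (x≋0 i)) (zeroʳ _)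
      ... | inj₁ _    | yes b≈0 = inj₂ λ i → trans (*-congʳ b≈0) (zeroˡ _)
      ... | inj₁ ax<0 | no b≉0  = inj₁ λ 0≤a → ax<0 (*-cancelˡ-≤ (≤∧≉⇒< 0≤b b≉0)
        (≤-resp-≈ (sym (zeroʳ b)) (⟨⟩-⊛ʳ a b x) 0≤a))
      lower-⟨⟩ R (resp x≋y p) with lower-⟨⟩ R p
      ... | inj₁ ax<0 = inj₁ λ 0≤a → ax<0 (≤-trans 0≤a (≤-reflexive (sym (⟨⟩-congʳ a x≋y))))
      ... | inj₂ x≋0  = inj₂ λ i → trans (sym (x≋y i)) (x≋0 i)

    cone-split : ∀ R {x} → Cone R x → ∃₂ λ y z → Cone (upper R) y × Cone (lower R) z × y ⊕ z ≋ x
    cone-split R {x} (generator r∈) with nonNegative? x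
    ... | yes 0≤ = x , 𝟎 , generator (∈-filter⁺ nonNegative? r∈ 0≤) , zero , λ i → +-identityʳ _
    ... | no  <0 =
      𝟎 , x , zero , generator (∈-filter⁺ (λ x → ¬? (nonNegative? x)) r∈ <0) , λ i → +-identityˡ _
    cone-split R zero = 𝟎 , 𝟎 , zero , zero , λ i → +-identityʳ _
    cone-split R (add p q) with cone-split R p | cone-split R q
    ... | y , z , cy , cz , eq | y′ , z′ , cy′ , cz′ , eq′ =
      y ⊕ y′ , z ⊕ z′ , add cy cy′ , add cz cz′ , λ i → trans
        (solve 4 (λ y y′ z z′ → (y :+ y′) :+ (z :+ z′) := (y :+ z) :+ (y′ :+ z′)) refl (y i) (y′ i) (z i) (z′ i))
        (+-cong (eq i) (eq′ i))
    cone-split R (scale {b} 0≤b p) with cone-split R p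
    ... | y , z , cy , cz , eq = b ⊛ y , b ⊛ z , scale 0≤b cy , scale 0≤b cz ,
      λ i → trans (sym (distribˡ _ _ _)) (*-congˡ (eq i))
    cone-split R (resp x≋y p) with cone-split R p
    ... | y , z , cy , cz , eq = y , z , cy , cz , λ i → trans (eq i) (x≋y i)

    cone-eliminate : ∀ R {y z} → Cone (upper R) y → Cone (lower R) z → Cone (cut R) (eliminate y z)
    cone-eliminate R {z = z} cy cz = cone-map (eliminate-linearˡ z)
      (λ {r} r∈ → cone-map (eliminate-linearʳ r)
        (λ s∈ → generator (∈-++⁺ʳ (upper R) (∈-cartesianProductWith⁺ eliminate r∈ s∈))) cz) cy

    -- If ⟨ a , y ⟩ > 0 then ⟨ a , y ⟩ (y + z) = ⟨ a , y + z ⟩ y + eliminate y z.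
    cut-complete : ∀ R {x} → Cone R x → 0# ≤ ⟨ a , x ⟩ → Cone (cut R) x
    cut-complete R {x} cx 0≤ax with cone-split R cx
    ... | y , z , cy , cz , y⊕z≋x with ⟨ a , y ⟩ ≤? 0#
    ... | no 0<ay = resp eq (scale 0≤i (add (scale 0≤ax (cone-mono ∈-++⁺ˡ cy)) (cone-eliminate R cy cz)))
      where
      inv = inverse-positive 0<ay
      ay⁻¹ = proj₁ inv
      0≤i = proj₂ (proj₂ inv)
      eq : ay⁻¹ ⊛ (⟨ a , x ⟩ ⊛ y ⊕ eliminate y z) ≋ x
      eq i = begin-equality
        ay⁻¹ * (⟨ a , x ⟩ * y i + (⟨ a , y ⟩ * z i + - ⟨ a , z ⟩ * y i))
          ≈⟨ *-congˡ (+-congʳ (*-congʳ (trans (sym (⟨⟩-congʳ a y⊕z≋x)) (⟨⟩-⊕ʳ a y z)))) ⟩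
        ay⁻¹ * ((⟨ a , y ⟩ + ⟨ a , z ⟩) * y i + (⟨ a , y ⟩ * z i + - ⟨ a , z ⟩ * y i))
          ≈⟨ solve 5 (λ j ay az y z → j :* ((ay :+ az) :* y :+ (ay :* z :+ (:- az) :* y))
                         := ay :* j :* (y :+ z)) refl ay⁻¹ ⟨ a , y ⟩ ⟨ a , z ⟩ (y i) (z i) ⟩
        ⟨ a , y ⟩ * ay⁻¹ * (y i + z i)
          ≈⟨ *-cong (proj₁ (proj₂ inv)) (y⊕z≋x i) ⟩
        1# * x i ≈⟨ *-identityˡ _ ⟩
        x i ∎
    ... | yes ay≤0 with lower-⟨⟩ R cz
    ... | inj₂ z≋0  = resp (λ i → trans (sym (trans (+-congˡ (z≋0 i)) (+-identityʳ _))) (y⊕z≋x i))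
                           (cone-mono ∈-++⁺ˡ cy)
    ... | inj₁ az<0 = ⊥-elim (az<0 (begin
      0#                     ≤⟨ 0≤ax ⟩
      ⟨ a , x ⟩              ≈⟨ ⟨⟩-congʳ a y⊕z≋x ⟨
      ⟨ a , y ⊕ z ⟩          ≈⟨ ⟨⟩-⊕ʳ a y z ⟩
      ⟨ a , y ⟩ + ⟨ a , z ⟩  ≤⟨ +-mono-≤ ay≤0 ≤-refl ⟩
      0# + ⟨ a , z ⟩         ≈⟨ +-identityˡ _ ⟩
      ⟨ a , z ⟩              ∎))

    cut-integral : IsIntegral a → ∀ R → (∀ {r} → r ∈ R → IsIntegral r) → ∀ {r} → r ∈ cut R → IsIntegral r
    cut-integral ha R hR r∈ with ∈-++⁻ (upper R) r∈
    ... | inj₁ r∈upper = hR (proj₁ (∈-filter⁻ nonNegative? {xs = R} r∈upper))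
    ... | inj₂ r∈prod with ∈-cartesianProductWith⁻ eliminate (upper R) (lower R) r∈prod
    ... | x , y , x∈ , y∈ , ≡.refl = λ i → integer-+
          (integer-* (integer-⟨⟩ ha hx) (hy i))
          (integer-* (integer-neg (integer-⟨⟩ ha hy)) (hx i))
      where
      hx = hR (proj₁ (∈-filter⁻ nonNegative? {xs = R} x∈))
      hy = hR (proj₁ (∈-filter⁻ (λ x → ¬? (nonNegative? x)) {xs = R} y∈))

  signedBasis : ∀ k → List (Vector Carrier k)
  signedBasis k = tabulate basis ++ tabulate (⊖_ ∘ basis)

  cone-signedBasis : ∀ {k} (x : Vector Carrier k) → Cone (signedBasis k) x
  cone-signedBasis {k} x = resp (combination-basis x) (go x basis (λ i → axis (x i) i))
    where
    axis : ∀ b i → Cone (signedBasis k) (b ⊛ basis i)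
    axis b i with total 0# b
    ... | inj₁ 0≤b = scale 0≤b (generator (∈-++⁺ˡ (∈-tabulate⁺ i)))
    ... | inj₂ b≤0 = resp (λ j → solve 2 (λ b e → (:- b) :* (:- e) := b :* e) refl b (basis i j))
      (scale (x≤0⇒0≤-x b≤0) (generator (∈-++⁺ʳ (tabulate basis) (∈-tabulate⁺ i))))
    go : ∀ {m} (s : Vector Carrier m) (v : Vector (Vector Carrier k) m) →
         (∀ i → Cone (signedBasis k) (s i ⊛ v i)) → Cone (signedBasis k) (combination v s)
    go {zero}  s v h = zero
    go {suc m} s v h = add (h zero) (go (s ∘ suc) (v ∘ suc) (h ∘ suc))

  integral-signedBasis : ∀ {k r} → r ∈ signedBasis k → IsIntegral r
  integral-signedBasis {k} r∈ with ∈-++⁻ (tabulate basis) r∈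
  ... | inj₁ r∈⁺ with ∈-tabulate⁻ {f = basis} r∈⁺
  ... | i , ≡.refl = integral-basis i
  integral-signedBasis {k} r∈ | inj₂ r∈⁻ with ∈-tabulate⁻ {f = ⊖_ ∘ basis} r∈⁻
  ... | i , ≡.refl = λ j → integer-neg (integral-basis i j)

  -- The double description method, for the cone of the x with ⟨ a , x ⟩ ≥ 0
  -- for all a in the list.
  generators : ∀ {k} → List (Vector Carrier k) → List (Vector Carrier k)
  generators {k} []       = signedBasis k
  generators     (a ∷ as) = cut a (generators as)

  generators-sound : ∀ {k} (as : List (Vector Carrier k)) {a r} → r ∈ generators as → a ∈ as →
                     0# ≤ ⟨ a , r ⟩
  generators-sound (a ∷ as) r∈ (here ≡.refl) = proj₁ (cut-sound a (generators as) r∈)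
  generators-sound (a ∷ as) r∈ (there {x} b∈) =
    proj₂ (cut-sound a (generators as) r∈) _ λ s∈ → generators-sound as s∈ b∈

  generators-complete : ∀ {k} (as : List (Vector Carrier k)) {x} → (∀ {a} → a ∈ as → 0# ≤ ⟨ a , x ⟩) →
                        Cone (generators as) x
  generators-complete []       {x} h = cone-signedBasis x
  generators-complete (a ∷ as) h =
    cut-complete a (generators as) (generators-complete as (h ∘ there)) (h (here ≡.refl))

  generators-integral : ∀ {k} (as : List (Vector Carrier k)) → (∀ {a} → a ∈ as → IsIntegral a) → ∀ {r} →
                      r ∈ generators as → IsIntegral r
  generators-integral []       h = integral-signedBasis
  generators-integral (a ∷ as) h =
    cut-integral a (h (here ≡.refl)) (generators as) (generators-integral as (h ∘ there))

module Convexity {c ℓ₁ ℓ₂ : Level} (ℝ : CompleteOrderedField c ℓ₁ ℓ₂) where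

  open OrderedField ℝ
  open LinearAlgebra ℝ
  open import Data.List.Extrema totalOrder using (argmin; f[argmin]≤f[xs])

  infixr 8 _⟪_⟫
  _⟪_⟫ : ∀ {k m} → Vector (Vector Carrier k) m → Vector Carrier k → Vector Carrier m
  (A ⟪ x ⟫) i = ⟨ A i , x ⟩

  ⟪⟫-linear : ∀ {k m} (A : Vector (Vector Carrier k) m) → IsLinear (A ⟪_⟫)
  ⟪⟫-linear A = record
    { f-cong = λ x≋y i → ⟨⟩-congʳ (A i) x≋y
    ; f-⊕    = λ x y i → ⟨⟩-⊕ʳ (A i) x y
    ; f-⊛    = λ b x i → ⟨⟩-⊛ʳ (A i) b x
    }

  sublinear-∘ : ∀ {k m} {g : Vector Carrier m → Carrier} {f : Vector Carrier k → Vector Carrier m} →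
                IsSublinear g → IsLinear f → IsSublinear (g ∘ f)
  sublinear-∘ sub lin = record
    { resp-≋      = λ x≋y → resp-≋ (f-cong x≋y)
    ; subadditive = λ x y → ≤-trans (resp-≋ (f-⊕ x y)) (subadditive _ _)
    ; homogeneous = λ x 0≤b → ≤-trans (resp-≋ (f-⊛ _ x)) (homogeneous _ 0≤b)
    }
    where
    open IsSublinear sub
    open IsLinear lin

  -- A sublinear g is at most the polyhedral function x ↦ ‖A x‖ as soon as it is
  -- so at finitely many points: the projections of the generators of the cone
  -- {(x , y) : |⟨ A i , x ⟩| ≤ y i}, on which ‖A x‖ is bounded by a linear function of y.
  module _ {k m} (A : Vector (Vector Carrier k) m) where

    private
      epigraph⁺ epigraph⁻ : Fin m → Vector Carrier (k ℕ.+ m)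
      epigraph⁺ i = A i Vector.++ basis i
      epigraph⁻ i = (⊖ A i) Vector.++ basis i

      epigraph : List (Vector Carrier (k ℕ.+ m))
      epigraph = tabulate epigraph⁺ ++ tabulate epigraph⁻

      ⟨epigraph⁺⟩ : ∀ i v → ⟨ epigraph⁺ i , v ⟩ ≈ ⟨ A i , Vector.take k v ⟩ + Vector.drop k v i
      ⟨epigraph⁺⟩ i v = trans (⟨⟩-++ˡ (A i) (basis i) v)
        (+-congˡ (trans (⟨⟩-comm (basis i) _) (⟨⟩-basisʳ (Vector.drop k v) i)))

      ⟨epigraph⁻⟩ : ∀ i v → ⟨ epigraph⁻ i , v ⟩ ≈ - ⟨ A i , Vector.take k v ⟩ + Vector.drop k v i
      ⟨epigraph⁻⟩ i v = trans (⟨⟩-++ˡ (⊖ A i) (basis i) v)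
        (+-cong (⟨⟩-⊖ˡ (A i) _) (trans (⟨⟩-comm (basis i) _) (⟨⟩-basisʳ (Vector.drop k v) i)))

      neg-+ : ∀ x y → - x + y ≈ y + - x
      neg-+ x y = +-comm _ _

      pos-+ : ∀ x y → x + y ≈ y + - - x
      pos-+ x y = trans (+-comm _ _) (+-congˡ (sym (-‿involutive x)))

      generator-bound : ∀ {v} → v ∈ generators epigraph → ∀ i →
                        abs ⟨ A i , Vector.take k v ⟩ ≤ Vector.drop k v i
      generator-bound {v} v∈ i = abs-lub
        (0≤y-x⇒x≤y (≤-resp-≈ refl (trans (⟨epigraph⁻⟩ i v) (neg-+ _ _))
          (generators-sound epigraph v∈ (∈-++⁺ʳ (tabulate epigraph⁺) (∈-tabulate⁺ i)))))
        (0≤y-x⇒x≤y (≤-resp-≈ refl (trans (⟨epigraph⁺⟩ i v) (pos-+ _ _))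
          (generators-sound epigraph v∈ (∈-++⁺ˡ (∈-tabulate⁺ i)))))

      epigraph-cone : ∀ x → Cone (generators epigraph) (x Vector.++ λ i → abs ⟨ A i , x ⟩)
      epigraph-cone x = generators-complete epigraph inequality
        where
        v = x Vector.++ λ i → abs ⟨ A i , x ⟩
        take-v : ∀ i → ⟨ A i , Vector.take k v ⟩ ≈ ⟨ A i , x ⟩
        take-v i = ⟨⟩-congʳ (A i) (λ j → reflexive (Vector.lookup-++ˡ x _ j))
        drop-v : ∀ i → Vector.drop k v i ≈ abs ⟨ A i , x ⟩
        drop-v i = reflexive (Vector.lookup-++ʳ x _ i)
        inequality : ∀ {a} → a ∈ epigraph → 0# ≤ ⟨ a , v ⟩
        inequality a∈ with ∈-++⁻ (tabulate epigraph⁺) a∈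
        ... | inj₁ a∈⁺ with ∈-tabulate⁻ {f = epigraph⁺} a∈⁺
        ... | i , ≡.refl = ≤-resp-≈ refl
          (sym (trans (⟨epigraph⁺⟩ i v) (trans (+-cong (take-v i) (drop-v i)) (pos-+ _ _))))
          (x≤y⇒0≤y-x (-x≤abs _))
        inequality a∈ | inj₂ a∈⁻ with ∈-tabulate⁻ {f = epigraph⁻} a∈⁻
        ... | i , ≡.refl = ≤-resp-≈ refl
          (sym (trans (⟨epigraph⁻⟩ i v) (trans (+-cong (-‿cong (take-v i)) (drop-v i)) (neg-+ _ _))))
          (x≤y⇒0≤y-x (x≤abs _))

    testPoints : List (Vector Carrier k)
    testPoints = List.map (Vector.take k) (generators epigraph)

    testPoints-integral : (∀ i → IsIntegral (A i)) → ∀ {r} → r ∈ testPoints → IsIntegral r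
    testPoints-integral hA r∈ with ∈-map⁻ (Vector.take k) r∈
    ... | v , v∈ , ≡.refl = λ j → generators-integral epigraph hE v∈ (j ↑ˡ m)
      where
      hE : ∀ {a} → a ∈ epigraph → IsIntegral a
      hE a∈ with ∈-++⁻ (tabulate epigraph⁺) a∈
      ... | inj₁ a∈⁺ with ∈-tabulate⁻ {f = epigraph⁺} a∈⁺
      ... | i , ≡.refl = integral-++ {x = A i} {y = basis i} (hA i) (integral-basis i)
      hE a∈ | inj₂ a∈⁻ with ∈-tabulate⁻ {f = epigraph⁻} a∈⁻
      ... | i , ≡.refl =
        integral-++ {x = ⊖ A i} {y = basis i} (λ j → integer-neg (hA i j)) (integral-basis i)

    module _ {w : Vector Carrier m} (0≤w : ∀ i → 0# ≤ w i) where

      test : ∀ {g} → IsSublinear g → (∀ {r} → r ∈ testPoints → g r ≤ weightedNorm w (A ⟪ r ⟫)) →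
             ∀ x → g x ≤ weightedNorm w (A ⟪ x ⟫)
      test {g} sub g≤ x = begin
        g x
          ≤⟨ resp-≋ (λ j → sym (reflexive (Vector.lookup-++ˡ x _ j))) ⟩
        g (Vector.take k v)                         ≤⟨ bound (epigraph-cone x) ⟩
        ⟨ w , Vector.drop k v ⟩
          ≈⟨ ⟨⟩-congʳ w (λ i → reflexive (Vector.lookup-++ʳ x _ i)) ⟩
        weightedNorm w (A ⟪ x ⟫)                    ∎
        where
        open IsSublinear sub
        v = x Vector.++ λ i → abs ⟨ A i , x ⟩
        bound : ∀ {v} → Cone (generators epigraph) v → g (Vector.take k v) ≤ ⟨ w , Vector.drop k v ⟩
        bound (generator {r} r∈) = ≤-trans (g≤ (∈-map⁺ (Vector.take k) r∈))
          (sum-mono (λ i → *-monoˡ-≤ (0≤w i) (generator-bound r∈ i)))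
        bound zero               = ≤-trans zero-≤ (≤-reflexive (sym (⟨⟩-𝟎ʳ w)))
        bound (add {x} {y} p q)  = begin
          g (Vector.take k (x ⊕ y))                       ≤⟨ subadditive _ _ ⟩
          g (Vector.take k x) + g (Vector.take k y)       ≤⟨ +-mono-≤ (bound p) (bound q) ⟩
          ⟨ w , Vector.drop k x ⟩ + ⟨ w , Vector.drop k y ⟩ ≈⟨ ⟨⟩-⊕ʳ w _ _ ⟨
          ⟨ w , Vector.drop k (x ⊕ y) ⟩                   ∎
        bound (scale {b} {x} 0≤b p) = begin
          g (Vector.take k (b ⊛ x))      ≤⟨ homogeneous _ 0≤b ⟩
          b * g (Vector.take k x)        ≤⟨ *-monoˡ-≤ 0≤b (bound p) ⟩
          b * ⟨ w , Vector.drop k x ⟩    ≈⟨ ⟨⟩-⊛ʳ w b _ ⟨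
          ⟨ w , Vector.drop k (b ⊛ x) ⟩  ∎
        bound (resp {x} {y} x≋y p) = begin
          g (Vector.take k y)       ≤⟨ resp-≋ (λ j → sym (x≋y (j ↑ˡ m))) ⟩
          g (Vector.take k x)       ≤⟨ bound p ⟩
          ⟨ w , Vector.drop k x ⟩   ≈⟨ ⟨⟩-congʳ w (λ i → x≋y (k ↑ʳ i)) ⟩
          ⟨ w , Vector.drop k y ⟩   ∎

  module _ {k m} (A : Vector (Vector Carrier k) m) {w : Vector Carrier m} (0≤w : ∀ i → 0# ≤ w i) where

    private
      closestPoint′ : ∀ x → ∃ λ y → ∀ y′ → weightedNorm w (x ⊕ A ⟪ y ⟫) ≤ weightedNorm w (x ⊕ A ⟪ y′ ⟫)
      closestPoint′ x = y★ , F-min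
        where
        homogenised : Vector (Vector Carrier (suc k)) m
        homogenised i = x i Vector.∷ A i

        f : Vector Carrier (suc k) → Carrier
        f v = weightedNorm w (homogenised ⟪ v ⟫)

        f-sublinear : IsSublinear f
        f-sublinear = sublinear-∘ (weightedNorm-isSublinear 0≤w) (⟪⟫-linear homogenised)
        open IsSublinear f-sublinear using (resp-≋; homogeneous)

        F : Vector Carrier k → Carrier
        F y = weightedNorm w (x ⊕ A ⟪ y ⟫)

        F≈f : ∀ y → f (1# Vector.∷ y) ≈ F y
        F≈f y = sum-cong-≋ (λ i → *-congˡ (abs-cong (+-congʳ (*-identityʳ (x i)))))

        dehomogenise : Vector Carrier (suc k) → Vector Carrier k
        dehomogenise v with v zero ≤? 0#
        ... | yes _  = 𝟎
        ... | no 0<t = proj₁ (inverse-positive 0<t) ⊛ (v ∘ suc)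

        candidates : List (Vector Carrier k)
        candidates = List.map dehomogenise (testPoints homogenised)

        y★ : Vector Carrier k
        y★ = argmin F 𝟎 candidates

        candidate-bound : ∀ {r} → r ∈ testPoints homogenised → F y★ ≤ F (dehomogenise r)
        candidate-bound r∈ = All.lookup (f[argmin]≤f[xs] {f = F} 𝟎 candidates) (∈-map⁺ dehomogenise r∈)

        scaled : ∀ r → F y★ ≤ F (dehomogenise r) → r zero * F y★ ≤ f r
        scaled r F≤ with r zero ≤? 0#
        ... | yes t≤0 = begin
          r zero * F y★          ≈⟨ solve 2 (λ t F → t :* F := :- ((:- t) :* F)) refl (r zero) (F y★) ⟩
          - (- r zero * F y★)
            ≤⟨ -‿antimono-≤ (*-nonNegative (x≤0⇒0≤-x t≤0) (weightedNorm-nonNegative 0≤w (x ⊕ A ⟪ y★ ⟫))) ⟩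
          - 0#                   ≈⟨ -0#≈0# ⟩
          0#                     ≤⟨ weightedNorm-nonNegative 0≤w (homogenised ⟪ r ⟫) ⟩
          f r                    ∎
        ... | no 0<t = begin
          t * F y★                          ≤⟨ *-monoˡ-≤ (≰⇒≥ 0<t) F≤ ⟩
          t * F (t⁻¹ ⊛ (r ∘ suc))           ≈⟨ *-congˡ (F≈f (t⁻¹ ⊛ (r ∘ suc))) ⟨
          t * f (1# Vector.∷ t⁻¹ ⊛ (r ∘ suc)) ≤⟨ *-monoˡ-≤ (≰⇒≥ 0<t) (resp-≋ rescale) ⟩
          t * f (t⁻¹ ⊛ r)                   ≤⟨ *-monoˡ-≤ (≰⇒≥ 0<t) (homogeneous r 0≤t⁻¹) ⟩
          t * (t⁻¹ * f r)                   ≈⟨ *-assoc _ _ _ ⟨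
          t * t⁻¹ * f r                     ≈⟨ *-congʳ tt⁻¹≈1 ⟩
          1# * f r                          ≈⟨ *-identityˡ _ ⟩
          f r                               ∎
          where
          t = r zero
          t⁻¹ = proj₁ (inverse-positive 0<t)
          tt⁻¹≈1 = proj₁ (proj₂ (inverse-positive 0<t))
          0≤t⁻¹ = proj₂ (proj₂ (inverse-positive 0<t))
          rescale : 1# Vector.∷ t⁻¹ ⊛ (r ∘ suc) ≋ t⁻¹ ⊛ r
          rescale zero    = sym (trans (*-comm _ _) tt⁻¹≈1)
          rescale (suc i) = refl

        F-min : ∀ y → F y★ ≤ F y
        F-min y = begin
          F y★                ≈⟨ *-identityˡ _ ⟨
          1# * F y★
            ≤⟨ test homogenised 0≤w height-sublinear (λ {r} r∈ → scaled r (candidate-bound r∈)) (1# Vector.∷ y) ⟩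
          f (1# Vector.∷ y)   ≈⟨ F≈f y ⟩
          F y                 ∎
          where
          height-sublinear : IsSublinear (λ v → v zero * F y★)
          height-sublinear = record
            { resp-≋      = λ x≋y → ≤-reflexive (*-congʳ (x≋y zero))
            ; subadditive = λ x y → ≤-reflexive (distribʳ _ _ _)
            ; homogeneous = λ x _ → ≤-reflexive (*-assoc _ _ _)
            }

    abstract
      closestPoint : ∀ x → ∃ λ y → ∀ y′ → weightedNorm w (x ⊕ A ⟪ y ⟫) ≤ weightedNorm w (x ⊕ A ⟪ y′ ⟫)
      closestPoint = closestPoint′

  -- Hahn–Banach

  -- A set of pairs (v , a), read as the requirements a ≤ u v on a functional u.
  record IsMinorant {k} (p : Vector Carrier k → Carrier)
                    (G : Vector Carrier k → Carrier → Set (c ⊔ ℓ₁ ⊔ ℓ₂)) : Set (c ⊔ ℓ₁ ⊔ ℓ₂) where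
    field
      G-0   : G 𝟎 0#
      G-+   : ∀ {v v′ a a′} → G v a → G v′ a′ → G (v ⊕ v′) (a + a′)
      G-*   : ∀ {b v a} → 0# ≤ b → G v a → G (b ⊛ v) (b * a)
      below : ∀ {v a} → G v a → a ≤ p v

  module _ {k} {p : Vector Carrier k → Carrier} (sub : IsSublinear p) where

    open IsSublinear sub

    private
      dilate : ∀ {s s⁻¹} → 0# ≤ s → s * s⁻¹ ≈ 1# → 0# ≤ s⁻¹ →
               ∀ v e → s * p (s⁻¹ ⊛ v ⊕ e) ≤ p (v ⊕ s ⊛ e)
      dilate {s} {s⁻¹} 0≤s ss⁻¹≈1 0≤s⁻¹ v e = begin
        s * p (s⁻¹ ⊛ v ⊕ e)            ≤⟨ *-monoˡ-≤ 0≤s (resp-≋ factor) ⟩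
        s * p (s⁻¹ ⊛ (v ⊕ s ⊛ e))      ≤⟨ *-monoˡ-≤ 0≤s (homogeneous (v ⊕ s ⊛ e) 0≤s⁻¹) ⟩
        s * (s⁻¹ * p (v ⊕ s ⊛ e))      ≈⟨ *-assoc s s⁻¹ (p (v ⊕ s ⊛ e)) ⟨
        s * s⁻¹ * p (v ⊕ s ⊛ e)        ≈⟨ *-congʳ ss⁻¹≈1 ⟩
        1# * p (v ⊕ s ⊛ e)             ≈⟨ *-identityˡ (p (v ⊕ s ⊛ e)) ⟩
        p (v ⊕ s ⊛ e)                  ∎
        where
        factor : s⁻¹ ⊛ v ⊕ e ≋ s⁻¹ ⊛ (v ⊕ s ⊛ e)
        factor i = begin-equality
          s⁻¹ * v i + e i               ≈⟨ +-congˡ (*-identityˡ (e i)) ⟨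
          s⁻¹ * v i + 1# * e i          ≈⟨ +-congˡ (*-congʳ ss⁻¹≈1) ⟨
          s⁻¹ * v i + s * s⁻¹ * e i
            ≈⟨ solve 4 (λ s t v e → t :* v :+ s :* t :* e := t :* (v :+ s :* e)) refl s s⁻¹ (v i) (e i) ⟩
          s⁻¹ * (v i + s * e i)         ∎

    module _ {G} (minorant : IsMinorant p G) (e : Vector Carrier k) where

      open IsMinorant minorant

      private
        separated : ∀ {v a v′ a′} → G v a → G v′ a′ → a′ + - p (v′ ⊕ ⊖ e) ≤ p (v ⊕ e) + - a
        separated {v} {a} {v′} {a′} g g′ = 0≤y-x⇒x≤y (≤-resp-≈ refl
          (solve 4 (λ P Q a a′ → (P :+ Q) :- (a :+ a′) := (P :- a) :- (a′ :- Q)) refl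
            (p (v ⊕ e)) (p (v′ ⊕ ⊖ e)) a a′)
          (x≤y⇒0≤y-x (begin
            a + a′                       ≤⟨ below (G-+ g g′) ⟩
            p (v ⊕ v′)
              ≤⟨ resp-≋ (λ i → solve 3 (λ v v′ e → v :+ v′ := (v :+ e) :+ (v′ :- e)) refl (v i) (v′ i) (e i)) ⟩
            p ((v ⊕ e) ⊕ (v′ ⊕ ⊖ e))     ≤⟨ subadditive (v ⊕ e) (v′ ⊕ ⊖ e) ⟩
            p (v ⊕ e) + p (v′ ⊕ ⊖ e)     ∎)))

        module _ {b} (b-lower : ∀ {v a} → G v a → b ≤ p (v ⊕ e) + - a)
                     (b-upper : ∀ {v a} → G v a → a + - p (v ⊕ ⊖ e) ≤ b) where

          positive : ∀ {v a s} → 0# < s → G v a → a + s * b ≤ p (v ⊕ s ⊛ e)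
          positive {v} {a} {s} 0<s g with inverse-positive 0<s
          ... | s⁻¹ , ss⁻¹≈1 , 0≤s⁻¹ = begin
            a + s * b
              ≤⟨ +-mono-≤ ≤-refl (*-monoˡ-≤ (≰⇒≥ 0<s) (b-lower (G-* 0≤s⁻¹ g))) ⟩
            a + s * (P + - (s⁻¹ * a))
              ≈⟨ solve 4 (λ a s t P → a :+ s :* (P :- t :* a) := s :* P :+ (a :- s :* t :* a)) refl a s s⁻¹ P ⟩
            s * P + (a + - (s * s⁻¹ * a))
              ≈⟨ +-congˡ (+-congˡ (-‿cong (trans (*-congʳ ss⁻¹≈1) (*-identityˡ a)))) ⟩
            s * P + (a + - a)                     ≈⟨ trans (+-congˡ (-‿inverseʳ a)) (+-identityʳ (s * P)) ⟩
            s * P                                 ≤⟨ dilate (≰⇒≥ 0<s) ss⁻¹≈1 0≤s⁻¹ v e ⟩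
            p (v ⊕ s ⊛ e)                         ∎
            where P = p (s⁻¹ ⊛ v ⊕ e)

          negative : ∀ {v a s} → 0# < s → G v a → a + - (s * b) ≤ p (v ⊕ s ⊛ (⊖ e))
          negative {v} {a} {s} 0<s g with inverse-positive 0<s
          ... | s⁻¹ , ss⁻¹≈1 , 0≤s⁻¹ = begin
            a + - (s * b)
              ≤⟨ +-mono-≤ ≤-refl (-‿antimono-≤ (*-monoˡ-≤ (≰⇒≥ 0<s) (b-upper (G-* 0≤s⁻¹ g)))) ⟩
            a + - (s * (s⁻¹ * a + - P))
              ≈⟨ solve 4 (λ a s t P → a :- s :* (t :* a :- P) := s :* P :+ (a :- s :* t :* a)) refl a s s⁻¹ P ⟩
            s * P + (a + - (s * s⁻¹ * a))
              ≈⟨ +-congˡ (+-congˡ (-‿cong (trans (*-congʳ ss⁻¹≈1) (*-identityˡ a)))) ⟩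
            s * P + (a + - a)                     ≈⟨ trans (+-congˡ (-‿inverseʳ a)) (+-identityʳ (s * P)) ⟩
            s * P                                 ≤⟨ dilate (≰⇒≥ 0<s) ss⁻¹≈1 0≤s⁻¹ v (⊖ e) ⟩
            p (v ⊕ s ⊛ (⊖ e))                     ∎
            where P = p (s⁻¹ ⊛ v ⊕ ⊖ e)

          between : ∀ {v a} → G v a → ∀ s → a + s * b ≤ p (v ⊕ s ⊛ e)
          between {v} {a} g s with s ≤? 0# | 0# ≤? s
          ... | no 0<s  | _       = positive 0<s g
          ... | yes s≤0 | yes 0≤s = begin
            a + s * b       ≈⟨ +-congˡ (trans (*-congʳ s≈0) (zeroˡ b)) ⟩
            a + 0#          ≈⟨ +-identityʳ a ⟩
            a               ≤⟨ below g ⟩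
            p v
              ≤⟨ resp-≋ (λ i → sym (trans (+-congˡ (trans (*-congʳ s≈0) (zeroˡ (e i)))) (+-identityʳ (v i)))) ⟩
            p (v ⊕ s ⊛ e)   ∎
            where s≈0 = ≤-antisym s≤0 0≤s
          ... | yes s≤0 | no s<0  = begin
            a + s * b               ≈⟨ +-congˡ (solve 2 (λ s b → s :* b := :- ((:- s) :* b)) refl s b) ⟩
            a + - (- s * b)
              ≤⟨ negative (λ -s≤0 → s<0 (≤-trans (x≤0⇒0≤-x -s≤0) (≤-reflexive (-‿involutive s)))) g ⟩
            p (v ⊕ (- s) ⊛ (⊖ e))
              ≤⟨ resp-≋ (λ i → +-congˡ (solve 2 (λ s e → (:- s) :* (:- e) := s :* e) refl s (e i))) ⟩
            p (v ⊕ s ⊛ e)           ∎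

      extend-by : ∃ λ b → ∀ {v a} → G v a → ∀ s → a + s * b ≤ p (v ⊕ s ⊛ e)
      extend-by with complete (λ r → ∃₂ λ v a → G v a × r ≈ p (v ⊕ e) + - a)
        (p (𝟎 ⊕ e) + - 0# , 𝟎 , 0# , G-0 , refl)
        (0# + - p (𝟎 ⊕ ⊖ e) , λ { r (v , a , g , r≈) → ≤-trans (separated g G-0) (≤-reflexive (sym r≈)) })
      ... | b , lower , greatest = b , between
        (λ g → lower _ (_ , _ , g , refl))
        (λ g → greatest _ λ { r (v , a , g′ , r≈) → ≤-trans (separated g′ g) (≤-reflexive (sym r≈)) })

    extend : ∀ {G} → IsMinorant p G → ∀ {m} (e : Vector (Vector Carrier k) m) →
             ∃ λ u → ∀ {v a} → G v a → ∀ s → a + ⟨ u , s ⟩ ≤ p (v ⊕ combination e s)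
    extend minorant {zero} e = 𝟎 , λ {v} {a} g s → begin
      a + 0#     ≈⟨ +-identityʳ a ⟩
      a          ≤⟨ IsMinorant.below minorant g ⟩
      p v        ≤⟨ resp-≋ (λ i → sym (+-identityʳ _)) ⟩
      p (v ⊕ 𝟎)  ∎
    extend {G} minorant {suc m} e with extend-by minorant (e zero)
    ... | b , hb with extend
          {G = λ v a → ∃₂ λ v′ a′ → ∃ λ s → G v′ a′ × v ≋ v′ ⊕ s ⊛ e zero × a ≈ a′ + s * b} (record
          { G-0   = 𝟎 , 0# , 0# , G-0
              , (λ i → sym (trans (+-identityˡ _) (zeroˡ _))) , sym (trans (+-identityˡ _) (zeroˡ _))
          ; G-+   = λ { {v} {v′} {a} {a′} (v₁ , a₁ , s₁ , g₁ , v≋₁ , a≈₁) (v₂ , a₂ , s₂ , g₂ , v≋₂ , a≈₂) →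
              v₁ ⊕ v₂ , a₁ + a₂ , s₁ + s₂ , G-+ g₁ g₂
              , (λ i → trans (+-cong (v≋₁ i) (v≋₂ i)) (rearrange (v₁ i) (v₂ i) s₁ s₂ (e zero i)))
              , trans (+-cong a≈₁ a≈₂) (rearrange a₁ a₂ s₁ s₂ b) }
          ; G-*   = λ { {t} 0≤t (v₁ , a₁ , s₁ , g₁ , v≋₁ , a≈₁) →
              t ⊛ v₁ , t * a₁ , t * s₁ , G-* 0≤t g₁
              , (λ i → trans (*-congˡ (v≋₁ i)) (distribute t (v₁ i) s₁ (e zero i)))
              , trans (*-congˡ a≈₁) (distribute t a₁ s₁ b) }
          ; below = λ { (v₁ , a₁ , s₁ , g₁ , v≋₁ , a≈₁) →
              ≤-trans (≤-reflexive a≈₁) (≤-trans (hb g₁ s₁) (resp-≋ (λ i → sym (v≋₁ i)))) }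
          }) (e ∘ suc)
      where
      open IsMinorant minorant
      rearrange : ∀ x y s t z → (x + s * z) + (y + t * z) ≈ (x + y) + (s + t) * z
      rearrange = solve 5 (λ x y s t z → (x :+ s :* z) :+ (y :+ t :* z) := (x :+ y) :+ (s :+ t) :* z) refl
      distribute : ∀ t x s z → t * (x + s * z) ≈ t * x + t * s * z
      distribute = solve 4 (λ t x s z → t :* (x :+ s :* z) := t :* x :+ t :* s :* z) refl
    ... | u , hu = b Vector.∷ u , λ {v} {a} g s → begin
      a + (b * s zero + ⟨ u , s ∘ suc ⟩)
        ≈⟨ solve 4 (λ a b s r → a :+ (b :* s :+ r) := (a :+ s :* b) :+ r) refl a b (s zero) _ ⟩
      (a + s zero * b) + ⟨ u , s ∘ suc ⟩
        ≤⟨ hu (v , a , s zero , g , (λ _ → refl) , refl) (s ∘ suc) ⟩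
      p ((v ⊕ s zero ⊛ e zero) ⊕ combination (e ∘ suc) (s ∘ suc))       ≤⟨ resp-≋ (λ i → +-assoc _ _ _) ⟩
      p (v ⊕ combination e s)                                           ∎

    hahnBanach : ∀ {G} → IsMinorant p G → ∃ λ u → ∀ {v a} → G v a → ∀ y → a + ⟨ u , y ⟩ ≤ p (v ⊕ y)
    hahnBanach minorant with extend minorant basis
    ... | u , hu = u , λ g y → ≤-trans (hu g y) (resp-≋ (λ i → +-congˡ (combination-basis y i)))

  orthogonalSubgradient : ∀ {k m} (A : Vector (Vector Carrier k) m) {p} → IsSublinear p → (∀ y → 0# ≤ p y) →
    ∀ x → (∀ y → p x ≤ p (x ⊕ A ⟪ y ⟫)) →
    ∃ λ u → (∀ y → p x + ⟨ u , y ⟩ ≤ p (x ⊕ y)) × (∀ y → ⟨ u , A ⟪ y ⟫ ⟩ ≈ 0#)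
  orthogonalSubgradient A {p} sub 0≤p x minimal = u , subgradient , orthogonal
    where
    open IsSublinear sub
    open IsLinear (⟪⟫-linear A)

    G : Vector Carrier _ → Carrier → Set _
    G v a = ∃₂ λ y t → 0# ≤ t × v ≋ t ⊛ x ⊕ A ⟪ y ⟫ × a ≈ t * p x

    scaled-minimal : ∀ {y t} → 0# ≤ t → t * p x ≤ p (t ⊛ x ⊕ A ⟪ y ⟫)
    scaled-minimal {y} {t} 0≤t with t ≤? 0#
    ... | yes t≤0 = begin
      t * p x                 ≈⟨ trans (*-congʳ (≤-antisym t≤0 0≤t)) (zeroˡ _) ⟩
      0#                      ≤⟨ 0≤p _ ⟩
      p (t ⊛ x ⊕ A ⟪ y ⟫)     ∎
    ... | no 0<t with inverse-positive 0<t
    ... | t⁻¹ , tt⁻¹≈1 , 0≤t⁻¹ = begin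
      t * p x                           ≤⟨ *-monoˡ-≤ 0≤t (minimal (t⁻¹ ⊛ y)) ⟩
      t * p (x ⊕ A ⟪ t⁻¹ ⊛ y ⟫)         ≤⟨ *-monoˡ-≤ 0≤t (resp-≋ (λ i → begin-equality
        x i + (A ⟪ t⁻¹ ⊛ y ⟫) i
          ≈⟨ +-cong (sym (trans (*-congʳ tt⁻¹≈1) (*-identityˡ _))) (f-⊛ t⁻¹ y i) ⟩
        t * t⁻¹ * x i + t⁻¹ * (A ⟪ y ⟫) i
          ≈⟨ solve 4 (λ t s x z → t :* s :* x :+ s :* z := s :* (t :* x :+ z)) refl t t⁻¹ (x i) _ ⟩
        t⁻¹ * (t * x i + (A ⟪ y ⟫) i)     ∎)) ⟩
      t * p (t⁻¹ ⊛ (t ⊛ x ⊕ A ⟪ y ⟫))   ≤⟨ *-monoˡ-≤ 0≤t (homogeneous _ 0≤t⁻¹) ⟩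
      t * (t⁻¹ * p (t ⊛ x ⊕ A ⟪ y ⟫))   ≈⟨ *-assoc _ _ _ ⟨
      t * t⁻¹ * p (t ⊛ x ⊕ A ⟪ y ⟫)     ≈⟨ trans (*-congʳ tt⁻¹≈1) (*-identityˡ _) ⟩
      p (t ⊛ x ⊕ A ⟪ y ⟫)               ∎

    minorant : IsMinorant p G
    minorant = record
      { G-0   = 𝟎 , 0# , ≤-refl
          , (λ i → sym (trans (+-cong (zeroˡ _) (⟨⟩-𝟎ʳ (A i))) (+-identityˡ _))) , sym (zeroˡ _)
      ; G-+   = λ { (y₁ , t₁ , 0≤t₁ , v≋₁ , a≈₁) (y₂ , t₂ , 0≤t₂ , v≋₂ , a≈₂) →
          y₁ ⊕ y₂ , t₁ + t₂ , +-nonNegative 0≤t₁ 0≤t₂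
          , (λ i → trans (+-cong (v≋₁ i) (v≋₂ i)) (trans
              (solve 5 (λ t s x y z → (t :* x :+ y) :+ (s :* x :+ z) := (t :+ s) :* x :+ (y :+ z)) refl t₁ t₂ (x i) _ _)
              (+-congˡ (sym (f-⊕ y₁ y₂ i)))))
          , trans (+-cong a≈₁ a≈₂) (sym (distribʳ _ _ _)) }
      ; G-*   = λ { {b} 0≤b (y , t , 0≤t , v≋ , a≈) →
          b ⊛ y , b * t , *-nonNegative 0≤b 0≤t
          , (λ i → trans (*-congˡ (v≋ i)) (trans (distribˡ _ _ _) (+-cong (sym (*-assoc _ _ _)) (sym (f-⊛ b y i)))))
          , trans (*-congˡ a≈) (sym (*-assoc _ _ _)) }
      ; below = λ { (y , t , 0≤t , v≋ , a≈) →
          ≤-trans (≤-reflexive a≈) (≤-trans (scaled-minimal 0≤t) (resp-≋ (λ i → sym (v≋ i)))) }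
      }

    u = proj₁ (hahnBanach sub minorant)

    dominated : ∀ {v a} → G v a → ∀ y → a + ⟨ u , y ⟩ ≤ p (v ⊕ y)
    dominated = proj₂ (hahnBanach sub minorant)

    subgradient : ∀ y → p x + ⟨ u , y ⟩ ≤ p (x ⊕ y)
    subgradient = dominated (𝟎 , 1# , 0≤1
      , (λ i → sym (trans (+-cong (*-identityˡ _) (⟨⟩-𝟎ʳ (A i))) (+-identityʳ _))) , sym (*-identityˡ _))

    in-image : ∀ y → G (A ⟪ y ⟫) 0#
    in-image y = y , 0# , ≤-refl , (λ i → sym (trans (+-congʳ (zeroˡ _)) (+-identityˡ _))) , sym (zeroˡ _)

    -- For z in the image, apply the bound to (z , 0) and the displacement - z.
    upper-bound : ∀ y → - ⟨ u , A ⟪ y ⟫ ⟩ ≤ 0#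
    upper-bound y = begin
      - ⟨ u , A ⟪ y ⟫ ⟩          ≈⟨ ⟨⟩-⊖ʳ u (A ⟪ y ⟫) ⟨
      ⟨ u , ⊖ (A ⟪ y ⟫) ⟩        ≈⟨ +-identityˡ _ ⟨
      0# + ⟨ u , ⊖ (A ⟪ y ⟫) ⟩   ≤⟨ dominated (in-image y) (⊖ (A ⟪ y ⟫)) ⟩
      p (A ⟪ y ⟫ ⊕ ⊖ (A ⟪ y ⟫))  ≤⟨ resp-≋ (λ i → -‿inverseʳ _) ⟩
      p 𝟎                        ≤⟨ zero-≤ ⟩
      0#                         ∎

    orthogonal : ∀ y → ⟨ u , A ⟪ y ⟫ ⟩ ≈ 0#
    orthogonal y = ≤-antisym
      (≤-trans (≤-reflexive (trans (sym (-‿involutive _)) (-‿cong negate))) (upper-bound (⊖ y)))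
      (≤-trans (x≤0⇒0≤-x (upper-bound y)) (≤-reflexive (-‿involutive _)))
      where
      negate : - ⟨ u , A ⟪ y ⟫ ⟩ ≈ ⟨ u , A ⟪ ⊖ y ⟫ ⟩
      negate = trans (sym (⟨⟩-⊖ʳ u (A ⟪ y ⟫))) (⟨⟩-congʳ u (λ i → sym (⟨⟩-⊖ʳ (A i) y)))

module CheegerConstant {c ℓ₁ ℓ₂ : Level} (ℝ : CompleteOrderedField c ℓ₁ ℓ₂) where

  open OrderedField ℝ
  open LinearAlgebra ℝ
  open Convexity ℝ
  open import Data.List.Extrema totalOrder using (argmin; f[argmin]≤f[xs]; argmin-all)

  ‖_‖₁ : ∀ {k} → Vector Carrier k → Carrier
  ‖ x ‖₁ = sum λ i → abs (x i)

  ‖‖₁-cong : ∀ {k} {x y : Vector Carrier k} → x ≋ y → ‖ x ‖₁ ≈ ‖ y ‖₁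
  ‖‖₁-cong x≋y = sum-cong-≋ (λ i → abs-cong (x≋y i))

  ‖‖₁-nonNegative : ∀ {k} (x : Vector Carrier k) → 0# ≤ ‖ x ‖₁
  ‖‖₁-nonNegative x = sum-nonNegative (λ i → abs-nonNegative (x i))

  ‖‖₁≈0⇒≋𝟎 : ∀ {k} {x : Vector Carrier k} → ‖ x ‖₁ ≈ 0# → x ≋ 𝟎
  ‖‖₁≈0⇒≋𝟎 {x = x} norm≈0 i = abs≈0⇒≈0 (sum≈0⇒≈0 (λ i → abs-nonNegative (x i)) norm≈0 i)

  ≋𝟎⇒‖‖₁≈0 : ∀ {k} {x : Vector Carrier k} → x ≋ 𝟎 → ‖ x ‖₁ ≈ 0#
  ≋𝟎⇒‖‖₁≈0 x≋𝟎 = sum-zero (λ i → trans (abs-cong (x≋𝟎 i)) abs-zero)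

  weightedNorm-1 : ∀ {k} (x : Vector Carrier k) → weightedNorm (λ _ → 1#) x ≈ ‖ x ‖₁
  weightedNorm-1 x = sum-cong-≋ (λ i → *-identityˡ (abs (x i)))

  module Distance {N M} (A : Vector (Vector Carrier M) N)
                  {w : Vector Carrier N} (0<w : ∀ i → 0# < w i) where

    open IsLinear (⟪⟫-linear A)
    private
      0≤w : ∀ i → 0# ≤ w i
      0≤w i = ≰⇒≥ (0<w i)
    open IsSublinear (weightedNorm-isSublinear 0≤w)

    InImage : Vector Carrier N → Set (c ⊔ ℓ₁)
    InImage x = ∃ λ y → x ≋ A ⟪ y ⟫

    norm : Vector Carrier N → Carrier
    norm = weightedNorm w

    norm-cong : ∀ {x y} → x ≋ y → norm x ≈ norm y
    norm-cong x≋y = ≤-antisym (resp-≋ x≋y) (resp-≋ (λ i → sym (x≋y i)))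

    norm-nonNegative : ∀ x → 0# ≤ norm x
    norm-nonNegative = weightedNorm-nonNegative 0≤w

    norm-𝟎 : norm 𝟎 ≈ 0#
    norm-𝟎 = sum-zero (λ i → trans (*-congˡ {w i} abs-zero) (zeroʳ (w i)))

    projection : Vector Carrier N → Vector Carrier M
    projection x = proj₁ (closestPoint A 0≤w x)

    reduced : Vector Carrier N → Vector Carrier N
    reduced x = x ⊕ A ⟪ projection x ⟫

    dist : Vector Carrier N → Carrier
    dist x = norm (reduced x)

    dist-≤ : ∀ x y → dist x ≤ norm (x ⊕ A ⟪ y ⟫)
    dist-≤ x = proj₂ (closestPoint A 0≤w x)

    dist-nonNegative : ∀ x → 0# ≤ dist x
    dist-nonNegative x = norm-nonNegative (reduced x)

    dist-isSublinear : IsSublinear dist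
    dist-isSublinear = record
      { resp-≋      = λ {x} {y} x≋y → ≤-trans (dist-≤ x (p y)) (resp-≋ (λ i → +-congʳ (x≋y i)))
      ; subadditive = λ x y → begin
          dist (x ⊕ y)                                       ≤⟨ dist-≤ (x ⊕ y) (p x ⊕ p y) ⟩
          norm ((x ⊕ y) ⊕ A ⟪ p x ⊕ p y ⟫)
            ≤⟨ resp-≋ (λ i → trans (+-congˡ (f-⊕ (p x) (p y) i))
            (solve 4 (λ x y z t → (x :+ y) :+ (z :+ t) := (x :+ z) :+ (y :+ t)) refl
              (x i) (y i) ((A ⟪ p x ⟫) i) ((A ⟪ p y ⟫) i))) ⟩
          norm (reduced x ⊕ reduced y)                       ≤⟨ subadditive (reduced x) (reduced y) ⟩
          dist x + dist y                                    ∎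
      ; homogeneous = λ {b} x 0≤b → begin
          dist (b ⊛ x)                      ≤⟨ dist-≤ (b ⊛ x) (b ⊛ p x) ⟩
          norm (b ⊛ x ⊕ A ⟪ b ⊛ p x ⟫)
            ≤⟨ resp-≋ (λ i → trans (+-congˡ (f-⊛ b (p x) i)) (sym (distribˡ b (x i) ((A ⟪ p x ⟫) i)))) ⟩
          norm (b ⊛ reduced x)              ≤⟨ homogeneous (reduced x) 0≤b ⟩
          b * dist x                        ∎
      }
      where p = projection

    dist≈0⇒InImage : ∀ {x} → dist x ≈ 0# → InImage x
    dist≈0⇒InImage {x} dist≈0 = ⊖ y , λ i → begin-equality
      x i
        ≈⟨ solve 2 (λ x z → x := (x :+ z) :- z) refl (x i) ((A ⟪ y ⟫) i) ⟩
      reduced x i + - (A ⟪ y ⟫) i                 ≈⟨ +-congʳ (weightedNorm≈0⇒≋𝟎 0<w dist≈0 i) ⟩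
      0# + - (A ⟪ y ⟫) i                          ≈⟨ +-identityˡ _ ⟩
      - (A ⟪ y ⟫) i                               ≈⟨ ⟨⟩-⊖ʳ (A i) y ⟨
      (A ⟪ ⊖ y ⟫) i                               ∎
      where y = projection x

    InImage⇒dist≈0 : ∀ {x} → InImage x → dist x ≈ 0#
    InImage⇒dist≈0 {x} (y , x≋Ay) = ≤-antisym (begin
      dist x                    ≤⟨ dist-≤ x (⊖ y) ⟩
      norm (x ⊕ A ⟪ ⊖ y ⟫)      ≤⟨ resp-≋ (λ i → trans (+-cong (x≋Ay i) (⟨⟩-⊖ʳ (A i) y)) (-‿inverseʳ _)) ⟩
      norm 𝟎                    ≈⟨ norm-𝟎 ⟩
      0#                        ∎) (dist-nonNegative x)

    reduced-minimal : ∀ x y → norm (reduced x) ≤ norm (reduced x ⊕ A ⟪ y ⟫)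
    reduced-minimal x y = ≤-trans (dist-≤ x (z ⊕ y)) (resp-≋ (λ i →
      trans (+-congˡ (f-⊕ z y i)) (sym (+-assoc _ _ _))))
      where z = projection x

    module Cheeger {P} (D : Vector (Vector Carrier N) P) (D-integral : ∀ i → IsIntegral (D i))
                   {x₀ : Vector Carrier N} (x₀-integral : IsIntegral x₀) (x₀∉Im : ¬ InImage x₀) where

      private
        f : Vector Carrier N → Carrier
        f x = ‖ D ⟪ x ⟫ ‖₁

        inv : Carrier → Carrier
        inv d with d ≤? 0#
        ... | yes _  = 0#
        ... | no 0<d = proj₁ (inverse-positive 0<d)

        inv-nonNegative : ∀ d → 0# ≤ inv d
        inv-nonNegative d with d ≤? 0#
        ... | yes _  = ≤-refl
        ... | no 0<d = proj₂ (proj₂ (inverse-positive 0<d))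

        inv-inverse : ∀ {d} → 0# < d → d * inv d ≈ 1#
        inv-inverse {d} 0<d with d ≤? 0#
        ... | yes d≤0 = ⊥-elim (0<d d≤0)
        ... | no 0<d  = proj₁ (proj₂ (inverse-positive 0<d))

        ratio : Vector Carrier N → Carrier
        ratio x = f x * inv (dist x)

        ratio-* : ∀ {x} → 0# < dist x → ratio x * dist x ≈ f x
        ratio-* {x} 0<d = begin-equality
          f x * inv (dist x) * dist x
            ≈⟨ solve 3 (λ f i d → f :* i :* d := d :* i :* f) refl (f x) (inv (dist x)) (dist x) ⟩
          dist x * inv (dist x) * f x     ≈⟨ *-congʳ (inv-inverse 0<d) ⟩
          1# * f x                        ≈⟨ *-identityˡ (f x) ⟩
          f x                             ∎

        0<dist? : ∀ x → Dec (0# < dist x)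
        0<dist? x = ¬? (dist x ≤? 0#)

        candidates : List (Vector Carrier N)
        candidates = filter 0<dist? (testPoints D)

      abstract
        minimiser : Vector Carrier N
        minimiser = argmin ratio x₀ candidates

        minimiser-integral : IsIntegral minimiser
        minimiser-integral = argmin-all ratio {P = IsIntegral} x₀-integral
          (All.tabulate λ r∈ → testPoints-integral D D-integral (proj₁ (∈-filter⁻ 0<dist? {xs = testPoints D} r∈)))

        0<dist-minimiser : 0# < dist minimiser
        0<dist-minimiser = argmin-all ratio {P = λ x → 0# < dist x}
          (λ d≤0 → x₀∉Im (dist≈0⇒InImage (≤-antisym d≤0 (dist-nonNegative x₀))))
          (All.tabulate λ r∈ → proj₂ (∈-filter⁻ 0<dist? {xs = testPoints D} r∈))

        private
          minimiser-least : ∀ {r} → r ∈ candidates → ratio minimiser ≤ ratio r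
          minimiser-least =
            All.lookup {P = λ r → ratio minimiser ≤ ratio r} (f[argmin]≤f[xs] {f = ratio} x₀ candidates)

      cheeger : Carrier
      cheeger = ratio minimiser

      cheeger-attained : cheeger * dist minimiser ≈ ‖ D ⟪ minimiser ⟫ ‖₁
      cheeger-attained = ratio-* {minimiser} 0<dist-minimiser

      cheeger-nonNegative : 0# ≤ cheeger
      cheeger-nonNegative = *-nonNegative (‖‖₁-nonNegative (D ⟪ minimiser ⟫)) (inv-nonNegative _)

      cheeger-bound : ∀ x → cheeger * dist x ≤ ‖ D ⟪ x ⟫ ‖₁
      cheeger-bound x = ≤-trans
        (test D {w = λ _ → 1#} (λ _ → 0≤1) cheeger-dist-isSublinear (λ {r} → at-testPoint {r}) x)
        (≤-reflexive (weightedNorm-1 (D ⟪ x ⟫)))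
        where
        open IsSublinear dist-isSublinear
          renaming (resp-≋ to d-resp; subadditive to d-subadditive; homogeneous to d-homogeneous)
        cheeger-dist-isSublinear : IsSublinear (λ x → cheeger * dist x)
        cheeger-dist-isSublinear = record
          { resp-≋      = λ x≋y → *-monoˡ-≤ cheeger-nonNegative (d-resp x≋y)
          ; subadditive =
            λ x y → ≤-trans (*-monoˡ-≤ cheeger-nonNegative (d-subadditive x y)) (≤-reflexive (distribˡ _ _ _))
          ; homogeneous = λ {b} x 0≤b → ≤-trans (*-monoˡ-≤ cheeger-nonNegative (d-homogeneous x 0≤b))
              (≤-reflexive (solve 3 (λ h b d → h :* (b :* d) := b :* (h :* d)) refl cheeger b (dist x)))
          }
        at-testPoint : ∀ {r} → r ∈ testPoints D → cheeger * dist r ≤ weightedNorm (λ _ → 1#) (D ⟪ r ⟫)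
        at-testPoint {r} r∈ with 0<dist? r
        ... | no ¬0<d = begin
          cheeger * dist r   ≈⟨ *-congˡ d≈0 ⟩
          cheeger * 0#       ≈⟨ zeroʳ cheeger ⟩
          0#                 ≤⟨ weightedNorm-nonNegative (λ _ → 0≤1) (D ⟪ r ⟫) ⟩
          weightedNorm (λ _ → 1#) (D ⟪ r ⟫) ∎
          where
          d≈0 : dist r ≈ 0#
          d≈0 with dist r ≤? 0#
          ... | yes d≤0 = ≤-antisym d≤0 (dist-nonNegative r)
          ... | no 0<d  = ⊥-elim (¬0<d 0<d)
        ... | yes 0<d = begin
          cheeger * dist r                     ≈⟨ *-comm cheeger (dist r) ⟩
          dist r * cheeger
            ≤⟨ *-monoˡ-≤ (≰⇒≥ 0<d) (minimiser-least (∈-filter⁺ 0<dist? r∈ 0<d)) ⟩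
          dist r * ratio r                     ≈⟨ *-comm (dist r) (ratio r) ⟩
          ratio r * dist r                     ≈⟨ ratio-* {r} 0<d ⟩
          f r                                  ≈⟨ weightedNorm-1 (D ⟪ r ⟫) ⟨
          weightedNorm (λ _ → 1#) (D ⟪ r ⟫)    ∎

-- Subsets and lists

∈-allSubsets : ∀ {n} (s : Subset n) → s ∈ allSubsets n
∈-allSubsets []            = here ≡.refl
∈-allSubsets (inside  ∷ s) = ∈-++⁺ˡ (∈-map⁺ (inside ∷_) (∈-allSubsets s))
∈-allSubsets (outside ∷ s) =
  ∈-++⁺ʳ (List.map (inside ∷_) (allSubsets _)) (∈-map⁺ (outside ∷_) (∈-allSubsets s))

allSubsets-unique : ∀ n → Unique (allSubsets n)
allSubsets-unique zero    = [] ∷ []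
allSubsets-unique (suc n) = Unique.++⁺
  (Unique.map⁺ Vec.∷-injectiveʳ (allSubsets-unique n))
  (Unique.map⁺ Vec.∷-injectiveʳ (allSubsets-unique n)) disjoint
  where
  disjoint : ∀ {s} → s ∈ List.map (inside ∷_) (allSubsets n) × s ∈ List.map (outside ∷_) (allSubsets n) →
             Empty.⊥
  disjoint (s∈₁ , s∈₂) with ∈-map⁻ (inside ∷_) s∈₁ | ∈-map⁻ (outside ∷_) s∈₂
  ... | _ , _ , ≡.refl | _ , _ , ()

lookup-injective : ∀ {a} {A : Set a} {xs : List A} → Unique xs → ∀ {i j} → lookup xs i ≡ lookup xs j → i ≡ j
lookup-injective (x∉xs ∷ u) {zero}  {zero}  _  = ≡.refl
lookup-injective (x∉xs ∷ u) {zero}  {suc j} eq = ⊥-elim (All.lookup x∉xs (∈-lookup j) eq)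
lookup-injective (x∉xs ∷ u) {suc i} {zero}  eq = ⊥-elim (All.lookup x∉xs (∈-lookup i) (≡.sym eq))
lookup-injective (x∉xs ∷ u) {suc i} {suc j} eq = ≡.cong suc (lookup-injective u eq)

module _ {a p q} {A : Set a} {P : Pred A p} {Q : Pred A q} (P? : Decidable P) (Q? : Decidable Q) where

  length-filter-cong : ∀ {xs} → (∀ {x} → x ∈ xs → (P x → Q x) × (Q x → P x)) →
                       length (filter P? xs) ≡ length (filter Q? xs)
  length-filter-cong {[]}     _   = ≡.refl
  length-filter-cong {x ∷ xs} P⇔Q with P? x | Q? x
  ... | yes _  | yes _  = ≡.cong suc (length-filter-cong (P⇔Q ∘ there))
  ... | no  _  | no  _  = length-filter-cong (P⇔Q ∘ there)
  ... | yes Px | no ¬Qx = ⊥-elim (¬Qx (proj₁ (P⇔Q (here ≡.refl)) Px))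
  ... | no ¬Px | yes Qx = ⊥-elim (¬Px (proj₂ (P⇔Q (here ≡.refl)) Qx))

  length-filter-remove : ∀ {y} → P y → ¬ Q y → (∀ {x} → x ≢ y → (P x → Q x) × (Q x → P x)) →
                         ∀ {xs} → Unique xs → y ∈ xs → length (filter P? xs) ≡ suc (length (filter Q? xs))
  length-filter-remove {y} Py ¬Qy P⇔Q {_ ∷ xs} (y∉xs ∷ _) (here ≡.refl)
    rewrite filter-accept P? {xs = xs} Py | filter-reject Q? {xs = xs} ¬Qy
    = ≡.cong suc (length-filter-cong (λ x∈ → P⇔Q (All.lookup y∉xs x∈ ∘ ≡.sym)))
  length-filter-remove {y} Py ¬Qy P⇔Q {x ∷ xs} (x∉xs ∷ u) (there y∈) with P? x | Q? x
  ... | yes _  | yes _  = ≡.cong suc (length-filter-remove Py ¬Qy P⇔Q u y∈)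
  ... | no  _  | no  _  = length-filter-remove Py ¬Qy P⇔Q u y∈
  ... | yes Px | no ¬Qx = ⊥-elim (¬Qx (proj₁ (P⇔Q (All.lookup x∉xs y∈)) Px))
  ... | no ¬Px | yes Qx = ⊥-elim (¬Px (proj₂ (P⇔Q (All.lookup x∉xs y∈)) Qx))

x∉p-x : ∀ {n} (p : Subset n) x → x ∉ₛ p - x
x∉p-x (s ∷ p) zero    ()
x∉p-x (s ∷ p) (suc x) (there x∈) = x∉p-x p x x∈

x∈p-y⇒x≢y : ∀ {n} (p : Subset n) {x y} → x ∈ₛ p - y → x ≢ y
x∈p-y⇒x≢y p x∈ ≡.refl = x∉p-x p _ x∈

x∈p-y⇒x∈p : ∀ {n} (p : Subset n) {x} y → x ∈ₛ p - y → x ∈ₛ p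
x∈p-y⇒x∈p p y = p─q⊆p p _

p-x-injective : ∀ {n} {p : Subset n} {x y} → y ∈ₛ p → p - x ≡ p - y → x ≡ y
p-x-injective {p = p} {x} {y} y∈p eq with x Fin.≟ y
... | yes x≡y = x≡y
... | no  x≢y = ⊥-elim (x∉p-x p y (≡.subst (y ∈ₛ_) eq (x∈p∧x≢y⇒x∈p-y y∈p (x≢y ∘ ≡.sym))))

∣p∣≡1+∣p-x∣ : ∀ {n} {p : Subset n} {x} → x ∈ₛ p → ∣ p ∣ ≡ suc ∣ p - x ∣
∣p∣≡1+∣p-x∣ {p = inside  ∷ p} here       = ≡.cong suc (≡.cong ∣_∣ (≡.sym (p─⊥≡p p)))
∣p∣≡1+∣p-x∣ {p = inside  ∷ p} (there x∈) = ≡.cong suc (∣p∣≡1+∣p-x∣ x∈)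
∣p∣≡1+∣p-x∣ {p = outside ∷ p} (there x∈) = ∣p∣≡1+∣p-x∣ x∈

∣p∣≡1+k⇒nonempty : ∀ {n k} {p : Subset n} → ∣ p ∣ ≡ suc k → Nonempty p
∣p∣≡1+k⇒nonempty {p = inside  ∷ p} _  = zero , here
∣p∣≡1+k⇒nonempty {p = outside ∷ p} eq with ∣p∣≡1+k⇒nonempty {p = p} eq
... | x , x∈p = suc x , there x∈p

⊆∧∣∣≡⇒≡ : ∀ {n} {p q : Subset n} → p ⊆ q → ∣ q ∣ ≡ ∣ p ∣ → q ≡ p
⊆∧∣∣≡⇒≡ {p = []}          {[]}          _   _  = ≡.refl
⊆∧∣∣≡⇒≡ {p = inside  ∷ p} {inside  ∷ q} p⊆q eq =
  ≡.cong (inside ∷_) (⊆∧∣∣≡⇒≡ (drop-∷-⊆ p⊆q) (ℕ.suc-injective eq))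
⊆∧∣∣≡⇒≡ {p = outside ∷ p} {outside ∷ q} p⊆q eq = ≡.cong (outside ∷_) (⊆∧∣∣≡⇒≡ (drop-∷-⊆ p⊆q) eq)
⊆∧∣∣≡⇒≡ {p = inside  ∷ p} {outside ∷ q} p⊆q eq with () ← p⊆q here
⊆∧∣∣≡⇒≡ {p = outside ∷ p} {inside  ∷ q} p⊆q eq =
  ⊥-elim (ℕ.<-irrefl ≡.refl (≡.subst (ℕ._≤ ∣ q ∣) (≡.sym eq) (p⊆q⇒∣p∣≤∣q∣ (drop-∷-⊆ p⊆q))))

⊆∧∣∣≡1+⇒IsFacet : ∀ {n} {p q : Subset n} → p ⊆ q → ∣ q ∣ ≡ suc ∣ p ∣ → IsFacet p q
⊆∧∣∣≡1+⇒IsFacet {p = []}          {[]}          _   ()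
⊆∧∣∣≡1+⇒IsFacet {p = inside  ∷ p} {outside ∷ q} p⊆q eq with () ← p⊆q here
⊆∧∣∣≡1+⇒IsFacet {p = outside ∷ p} {inside  ∷ q} p⊆q eq =
  zero , here , ≡.cong (outside ∷_) (≡.trans (p─⊥≡p q) (⊆∧∣∣≡⇒≡ (drop-∷-⊆ p⊆q) (ℕ.suc-injective eq)))
⊆∧∣∣≡1+⇒IsFacet {p = inside  ∷ p} {inside  ∷ q} p⊆q eq with ⊆∧∣∣≡1+⇒IsFacet (drop-∷-⊆ p⊆q) (ℕ.suc-injective eq)
... | v , v∈q , q-v≡p = suc v , there v∈q , ≡.cong (inside ∷_) q-v≡p
⊆∧∣∣≡1+⇒IsFacet {p = outside ∷ p} {outside ∷ q} p⊆q eq with ⊆∧∣∣≡1+⇒IsFacet (drop-∷-⊆ p⊆q) eq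
... | v , v∈q , q-v≡p = suc v , there v∈q , ≡.cong (outside ∷_) q-v≡p

private
  below? : ∀ {n} (σ : Subset n) (v : Fin n) → Decidable (λ w → w ∈ₛ σ × w Fin.< v)
  below? σ v w = (w ∈? σ) ×-dec (w Fin.<? v)

position-remove-above : ∀ {n} (σ : Subset n) {u v} → u Fin.< v → position (σ - v) u ≡ position σ u
position-remove-above {n} σ {u} {v} u<v =
  length-filter-cong (below? (σ - v) u) (below? σ u) {allFin n} λ _ →
  (λ { (w∈ , w<u) → x∈p-y⇒x∈p σ v w∈ , w<u }) ,
  (λ { (w∈ , w<u) → x∈p∧x≢y⇒x∈p-y w∈ (Fin.<⇒≢ (Fin.<-trans w<u u<v)) , w<u })

position-remove-below : ∀ {n} (σ : Subset n) {u v} → u ∈ₛ σ → u Fin.< v →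
                    position σ v ≡ suc (position (σ - u) v)
position-remove-below {n} σ {u} {v} u∈σ u<v = length-filter-remove (below? σ v) (below? (σ - u) v)
  (u∈σ , u<v) (x∉p-x σ u ∘ proj₁)
  (λ w≢u → (λ { (w∈ , w<v) → x∈p∧x≢y⇒x∈p-y w∈ w≢u , w<v }) , (λ { (w∈ , w<v) → x∈p-y⇒x∈p σ u w∈ , w<v }))
  (Unique.allFin⁺ n) (∈-allFin u)

module Coboundary {c ℓ₁ ℓ₂ : Level} (ℝ : CompleteOrderedField c ℓ₁ ℓ₂)
                  {n : ℕ} (K : SimplicialComplex n) (ω : Orientation n) where

  open OrderedField ℝ hiding (_-_)
  open LinearAlgebra ℝ
    using (sum-zero; sum-cong-≋; ∑-distrib-+; *-distribˡ-sum; IsInteger; integer-0; integer-1; integer-neg)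
  open Cochains ℝ K ω using (simplices; simplex; #; incidence; B; δ; deg; Cochain)
  open SimplicialComplex K
  open Orientation ω
  open import Algebra.Properties.Semiring.Sum semiring using (∑-comm; *-distribʳ-sum)

  sum-single : ∀ {k} {f : Vector Carrier k} i → (∀ j → j ≢ i → f j ≈ 0#) → sum f ≈ f i
  sum-single zero    f≈0 = trans (+-congˡ (sum-zero (λ j → f≈0 (suc j) λ ()))) (+-identityʳ _)
  sum-single (suc i) f≈0 = trans
    (+-cong (f≈0 zero λ ()) (sum-single i (λ j j≢i → f≈0 (suc j) (j≢i ∘ Fin.suc-injective)))) (+-identityˡ _)

  sum-antisymmetric : ∀ {k} (f : Fin k → Fin k → Carrier) → (∀ i j → f i j + f j i ≈ 0#) →
                      sum (λ i → sum (λ j → f i j)) ≈ 0#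
  sum-antisymmetric f f≈-f = x+x≈0⇒x≈0 (begin-equality
    sum (λ i → sum (λ j → f i j)) + sum (λ i → sum (λ j → f i j))   ≈⟨ +-congˡ (∑-comm f) ⟩
    sum (λ i → sum (λ j → f i j)) + sum (λ i → sum (λ j → f j i))
      ≈⟨ ∑-distrib-+ (λ i → sum (λ j → f i j)) (λ i → sum (λ j → f j i)) ⟨
    sum (λ i → sum (λ j → f i j) + sum (λ j → f j i))
      ≈⟨ sum-zero (λ i → trans (sym (∑-distrib-+ (f i) (λ j → f j i))) (sum-zero (f≈-f i))) ⟩
    0#                                                              ∎)

  fromSign-* : ∀ s t → fromSign (s Sign.* t) ≈ fromSign s * fromSign t
  fromSign-* Sign.+ t      = sym (*-identityˡ _)
  fromSign-* Sign.- Sign.+ = sym (*-identityʳ _)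
  fromSign-* Sign.- Sign.- =
    trans (sym (*-identityʳ 1#)) (solve 1 (λ x → x :* x := (:- x) :* (:- x)) refl 1#)

  fromSign-square : ∀ s → fromSign s * fromSign s ≈ 1#
  fromSign-square s = trans (sym (fromSign-* s s)) (reflexive (≡.cong fromSign (Sign.s*s≡+ s)))

  fromSign-opposite : ∀ s → fromSign (Sign.opposite s) ≈ - fromSign s
  fromSign-opposite Sign.+ = refl
  fromSign-opposite Sign.- = sym (-‿involutive 1#)

  fromSign≉0 : ∀ s → ¬ fromSign s ≈ 0#
  fromSign≉0 s s≈0 = 0≉1 (trans (sym (zeroˡ _)) (trans (*-congʳ (sym s≈0)) (fromSign-square s)))

  fromSign-integer : ∀ s → IsInteger (fromSign s)
  fromSign-integer Sign.+ = integer-1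
  fromSign-integer Sign.- = integer-neg integer-1

  private
    facetAt? : ∀ (v : Fin n) τ σ → Dec (v ∈ₛ σ × σ - v ≡ τ)
    facetAt? v τ σ = (v ∈? σ) ×-dec Vec.≡-dec Bool._≟_ (σ - v) τ

  incidenceAt : Fin n → Subset n → Subset n → Carrier
  incidenceAt v τ σ = if does (facetAt? v τ σ)
    then fromSign (sign τ Sign.* sign σ Sign.* -1^ (position σ v)) else 0#

  incidenceAt-facet : ∀ {v τ σ} → v ∈ₛ σ → σ - v ≡ τ →
                      incidenceAt v τ σ ≡ fromSign (sign τ Sign.* sign σ Sign.* -1^ (position σ v))
  incidenceAt-facet {v} {τ} {σ} v∈σ eq rewrite dec-true (facetAt? v τ σ) (v∈σ , eq) = ≡.refl

  incidenceAt-nonfacet : ∀ {v τ σ} → ¬ (v ∈ₛ σ × σ - v ≡ τ) → incidenceAt v τ σ ≡ 0#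
  incidenceAt-nonfacet {v} {τ} {σ} ¬facet rewrite dec-false (facetAt? v τ σ) ¬facet = ≡.refl

  incidence-sum : ∀ τ σ → incidence τ σ ≈ sum λ v → incidenceAt v τ σ
  incidence-sum τ σ with isFacet? τ σ
  ... | no ¬facet = sym (sum-zero (λ v → reflexive (incidenceAt-nonfacet (λ h → ¬facet (v , h)))))
  ... | yes (v , v∈σ , eq) = sym (trans
    (sum-single v (λ u u≢v → reflexive (incidenceAt-nonfacet λ { (u∈σ , eq′) →
      u≢v (p-x-injective v∈σ (≡.trans eq′ (≡.sym eq))) })))
    (reflexive (incidenceAt-facet v∈σ eq)))

  ∈-simplices⁺ : ∀ {d σ} → IsFace σ → ∣ σ ∣ ≡ suc d → σ ∈ simplices d
  ∈-simplices⁺ {d} {σ} face size =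
    ∈-filter⁺ (λ σ → isFace? σ ×-dec (∣ σ ∣ ℕ.≟ suc d)) (∈-allSubsets σ) (face , size)

  ∈-simplices⁻ : ∀ {d σ} → σ ∈ simplices d → IsFace σ × ∣ σ ∣ ≡ suc d
  ∈-simplices⁻ {d} σ∈ = proj₂ (∈-filter⁻ (λ σ → isFace? σ ×-dec (∣ σ ∣ ℕ.≟ suc d)) {xs = allSubsets n} σ∈)

  simplex-isFace : ∀ d i → IsFace (simplex d i) × ∣ simplex d i ∣ ≡ suc d
  simplex-isFace d i = ∈-simplices⁻ (∈-lookup i)

  simplex-surjective : ∀ {d σ} → IsFace σ → ∣ σ ∣ ≡ suc d → ∃ λ i → simplex d i ≡ σ
  simplex-surjective face size = Any.index σ∈ , ≡.sym (lookup-index σ∈)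
    where σ∈ = ∈-simplices⁺ face size

  simplex-injective : ∀ {d i j} → simplex d i ≡ simplex d j → i ≡ j
  simplex-injective = lookup-injective (Unique.filter⁺ _ (allSubsets-unique n))

  private
    module TwoSteps (τ ρ : Subset n) where

      Removes : Fin n → Fin n → Set
      Removes v u = v ∈ₛ ρ × u ∈ₛ ρ - v × ρ - v - u ≡ τ

      removes? : ∀ v u → Dec (Removes v u)
      removes? v u = (v ∈? ρ) ×-dec ((u ∈? (ρ - v)) ×-dec Vec.≡-dec Bool._≟_ (ρ - v - u) τ)

      removes-sym : ∀ {v u} → Removes v u → Removes u v
      removes-sym {v} {u} (v∈ , u∈ , eq) =
        x∈p-y⇒x∈p ρ v u∈ , x∈p∧x≢y⇒x∈p-y v∈ (x∈p-y⇒x≢y ρ u∈ ∘ ≡.sym) , ≡.trans (p─x─y≡p─y─x ρ u v) eq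

      through : Fin n → Fin n → Subset n → Carrier
      through v u σ = incidenceAt v σ ρ * incidenceAt u τ σ

      parity : Fin n → Fin n → Carrier
      parity v u = fromSign (-1^ (position ρ v)) * fromSign (-1^ (position (ρ - v) u))

      through-facet : ∀ {v u} → Removes v u →
                      through v u (ρ - v) ≈ fromSign (sign ρ) * fromSign (sign τ) * parity v u
      through-facet {v} {u} (v∈ , u∈ , eq) = begin-equality
        through v u (ρ - v)
          ≈⟨ *-cong (reflexive (incidenceAt-facet v∈ ≡.refl)) (reflexive (incidenceAt-facet u∈ eq)) ⟩
        fromSign (sσ Sign.* sign ρ Sign.* a) * fromSign (sign τ Sign.* sσ Sign.* b)
          ≈⟨ *-cong (expand sσ (sign ρ) a) (expand (sign τ) sσ b) ⟩
        fromSign sσ * fromSign (sign ρ) * fromSign a * (fromSign (sign τ) * fromSign sσ * fromSign b)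
          ≈⟨ solve 5 (λ s r t a b → s :* r :* a :* (t :* s :* b) := s :* s :* (r :* t :* (a :* b))) refl
               (fromSign sσ) (fromSign (sign ρ)) (fromSign (sign τ)) (fromSign a) (fromSign b) ⟩
        fromSign sσ * fromSign sσ * (fromSign (sign ρ) * fromSign (sign τ) * parity v u)
          ≈⟨ *-congʳ (fromSign-square sσ) ⟩
        1# * (fromSign (sign ρ) * fromSign (sign τ) * parity v u)
          ≈⟨ *-identityˡ _ ⟩
        fromSign (sign ρ) * fromSign (sign τ) * parity v u ∎
        where
        sσ = sign (ρ - v)
        a = -1^ (position ρ v)
        b = -1^ (position (ρ - v) u)
        expand : ∀ r s t → fromSign (r Sign.* s Sign.* t) ≈ fromSign r * fromSign s * fromSign t
        expand r s t = trans (fromSign-* (r Sign.* s) t) (*-congʳ (fromSign-* r s))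

      through-nonfacet : ∀ {v u σ} → ρ - v ≢ σ → through v u σ ≈ 0#
      through-nonfacet ρ-v≢σ = trans (*-congʳ (reflexive (incidenceAt-nonfacet (ρ-v≢σ ∘ proj₂)))) (zeroˡ _)

      through-nonremoves : ∀ {v u} → ¬ Removes v u → ∀ σ → through v u σ ≈ 0#
      through-nonremoves {v} {u} ¬r σ with facetAt? v σ ρ
      ... | no ¬facet = trans (*-congʳ (reflexive (incidenceAt-nonfacet ¬facet))) (zeroˡ _)
      ... | yes (v∈ , ≡.refl) = trans (*-congˡ (reflexive (incidenceAt-nonfacet
        λ { (u∈ , eq) → ¬r (v∈ , u∈ , eq) }))) (zeroʳ _)

      parity-< : ∀ {v u} → v ∈ₛ ρ → v Fin.< u → parity u v ≈ - parity v u
      parity-< {v} {u} v∈ v<u = begin-equality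
        fromSign (-1^ (position ρ u)) * fromSign (-1^ (position (ρ - u) v))
          ≡⟨ ≡.cong₂ (λ i j → fromSign (-1^ i) * fromSign (-1^ j))
               (position-remove-below ρ v∈ v<u) (position-remove-above ρ v<u) ⟩
        fromSign (Sign.opposite a) * fromSign b    ≈⟨ *-congʳ (fromSign-opposite a) ⟩
        - fromSign a * fromSign b
          ≈⟨ solve 2 (λ a b → (:- a) :* b := :- (b :* a)) refl (fromSign a) (fromSign b) ⟩
        - (fromSign b * fromSign a)                ∎
        where
        a = -1^ (position (ρ - v) u)
        b = -1^ (position ρ v)

      parity-antisym : ∀ {v u} → Removes v u → parity v u + parity u v ≈ 0#
      parity-antisym {v} {u} (v∈ , u∈ , _) with Fin.<-cmp v u
      ... | tri< v<u _ _ = trans (+-congˡ (parity-< v∈ v<u)) (-‿inverseʳ _)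
      ... | tri≈ _ v≡u _ = ⊥-elim (x∈p-y⇒x≢y ρ u∈ (≡.sym v≡u))
      ... | tri> _ _ u<v = trans (+-congʳ (parity-< (x∈p-y⇒x∈p ρ v u∈) u<v)) (-‿inverseˡ _)

      module _ {d} (ρ-face : IsFace ρ) (ρ-size : ∣ ρ ∣ ≡ suc (suc d)) where

        total-through : Fin n → Fin n → Carrier
        total-through v u = sum λ i → through v u (simplex d i)

        total-through-removes : ∀ {v u} → Removes v u →
          total-through v u ≈ fromSign (sign ρ) * fromSign (sign τ) * parity v u
        total-through-removes {v} {u} r@(v∈ , _) 
          with simplex-surjective {d} (down-closed ρ-face (x∈p-y⇒x∈p ρ v) (∣p∣≡1+k⇒nonempty size)) size
          where size = ℕ.suc-injective (≡.trans (≡.sym (∣p∣≡1+∣p-x∣ v∈)) ρ-size)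
        ... | i , σᵢ≡ρ-v = begin-equality
          total-through v u         ≈⟨ sum-single i (λ j j≢i → through-nonfacet (λ ρ-v≡σⱼ →
            j≢i (simplex-injective (≡.sym (≡.trans σᵢ≡ρ-v ρ-v≡σⱼ))))) ⟩
          through v u (simplex d i) ≡⟨ ≡.cong (through v u) σᵢ≡ρ-v ⟩
          through v u (ρ - v)       ≈⟨ through-facet r ⟩
          fromSign (sign ρ) * fromSign (sign τ) * parity v u ∎

        total-through-antisym : ∀ v u → total-through v u + total-through u v ≈ 0#
        total-through-antisym v u with removes? v u
        ... | yes r = begin-equality
          total-through v u + total-through u v
            ≈⟨ +-cong (total-through-removes r) (total-through-removes (removes-sym r)) ⟩
          s * parity v u + s * parity u v          ≈⟨ distribˡ _ _ _ ⟨
          s * (parity v u + parity u v)            ≈⟨ *-congˡ (parity-antisym r) ⟩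
          s * 0#                                   ≈⟨ zeroʳ s ⟩
          0#                                       ∎
          where s = fromSign (sign ρ) * fromSign (sign τ)
        ... | no ¬r = trans (+-cong
          (sum-zero (λ i → through-nonremoves ¬r (simplex d i)))
          (sum-zero (λ i → through-nonremoves (¬r ∘ removes-sym) (simplex d i)))) (+-identityʳ 0#)

        incidence-incidence : (sum λ i → incidence (simplex d i) ρ * incidence τ (simplex d i)) ≈ 0#
        incidence-incidence = begin-equality
          (sum λ i → incidence (simplex d i) ρ * incidence τ (simplex d i))
            ≈⟨ sum-cong-≋ (λ i → *-cong (incidence-sum (simplex d i) ρ) (incidence-sum τ (simplex d i))) ⟩
          (sum λ i → (sum λ v → incidenceAt v (simplex d i) ρ) * (sum λ u → incidenceAt u τ (simplex d i)))
            ≈⟨ sum-cong-≋ (λ i → trans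
                 (*-distribʳ-sum (sum λ u → incidenceAt u τ (simplex d i)) (λ v → incidenceAt v (simplex d i) ρ))
                 (sum-cong-≋ (λ v → *-distribˡ-sum (incidenceAt v (simplex d i) ρ) (λ u → incidenceAt u τ (simplex d i))))) ⟩
          (sum λ i → sum λ v → sum λ u → through v u (simplex d i))
            ≈⟨ ∑-comm (λ i v → sum λ u → through v u (simplex d i)) ⟩
          (sum λ v → sum λ i → sum λ u → through v u (simplex d i))
            ≈⟨ sum-cong-≋ (λ v → ∑-comm (λ i u → through v u (simplex d i))) ⟩
          (sum λ v → sum λ u → total-through v u)
            ≈⟨ sum-antisymmetric total-through total-through-antisym ⟩
          0# ∎

  -- For τ empty this is the case d = 0 of δ δ = 0, with the augmentation.
  incidence-B : ∀ d τ j → (sum λ i → B d i j * incidence τ (simplex d i)) ≈ 0#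
  incidence-B d τ j = TwoSteps.incidence-incidence τ (simplex (suc d) j) face size
    where
    face = proj₁ (simplex-isFace (suc d) j)
    size = proj₂ (simplex-isFace (suc d) j)

  incidence-facet : ∀ {τ σ} → IsFacet τ σ → ∃ λ s → incidence τ σ ≡ fromSign s
  incidence-facet {τ} {σ} facet with isFacet? τ σ
  ... | yes (v , _)  = sign τ Sign.* sign σ Sign.* -1^ (position σ v) , ≡.refl
  ... | no ¬facet    = ⊥-elim (¬facet facet)

  incidence-integer : ∀ τ σ → IsInteger (incidence τ σ)
  incidence-integer τ σ with isFacet? τ σ
  ... | yes (v , _) = fromSign-integer (sign τ Sign.* sign σ Sign.* -1^ (position σ v))
  ... | no _        = integer-0

  -- The empty set is the only facet of a vertex, and a vertex is oriented by +.
  incidence-vertex : ∀ i → incidence ⊥ (simplex 0 i) ≈ fromSign (sign ⊥)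
  incidence-vertex i with ∣p∣≡1+k⇒nonempty (proj₂ (simplex-isFace 0 i))
  ... | v , v∈ = begin-equality
    incidence ⊥ (simplex 0 i)     ≈⟨ incidence-sum ⊥ (simplex 0 i) ⟩
    (sum λ u → incidenceAt u ⊥ (simplex 0 i)) ≈⟨ sum-single v (λ u u≢v → reflexive (incidenceAt-nonfacet λ { (u∈ , eq) →
      ∉⊥ (≡.subst (v ∈ₛ_) eq (x∈p∧x≢y⇒x∈p-y v∈ (u≢v ∘ ≡.sym))) })) ⟩
    incidenceAt v ⊥ (simplex 0 i) ≡⟨ incidenceAt-facet v∈ σ-v≡⊥ ⟩
    fromSign (sign ⊥ Sign.* sign (simplex 0 i) Sign.* -1^ (position (simplex 0 i) v))
      ≡⟨ ≡.cong₂ (λ s k → fromSign (sign ⊥ Sign.* s Sign.* -1^ k)) (vertex size) position≡0 ⟩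
    fromSign (sign ⊥ Sign.* Sign.+ Sign.* Sign.+)
      ≡⟨ ≡.cong fromSign (≡.trans (Sign.*-identityʳ (sign ⊥ Sign.* Sign.+)) (Sign.*-identityʳ (sign ⊥))) ⟩
    fromSign (sign ⊥) ∎
    where
    σ = simplex 0 i
    size = proj₂ (simplex-isFace 0 i)
    σ-v≡⊥ : σ - v ≡ ⊥
    σ-v≡⊥ = ⊆∧∣∣≡⇒≡ ⊥⊆ (≡.trans (ℕ.suc-injective (≡.trans (≡.sym (∣p∣≡1+∣p-x∣ v∈)) size)) (≡.sym (∣⊥∣≡0 n)))
    position≡0 : position σ v ≡ 0
    position≡0 =
      ≡.cong length (filter-none (below? σ v) {xs = allFin n} (All.tabulate λ { {w} _ (w∈ , w<v) →
      ∉⊥ (≡.subst (w ∈ₛ_) σ-v≡⊥ (x∈p∧x≢y⇒x∈p-y w∈ (Fin.<⇒≢ w<v))) }))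

module CheegerConstantOfComplex {c ℓ₁ ℓ₂ : Level} (ℝ : CompleteOrderedField c ℓ₁ ℓ₂)
                  {n : ℕ} (K : SimplicialComplex n) (ω : Orientation n) (d : ℕ) where

  open OrderedField ℝ hiding (_-_; _<_)
  open LinearAlgebra ℝ hiding (IsIntegral)
  open Convexity ℝ
  open CheegerConstant ℝ
  open Coboundary ℝ K ω
  open Cochains ℝ K ω hiding (_≋_; 𝟎; _⊕_; _⊖_; ⟨_,_⟩; ‖_‖₁)
  private
    module 𝔽 = OrderedField ℝ

  filter-nonempty : ∀ {a p} {A : Set a} {P : Pred A p} (P? : Decidable P) {xs} →
                    0 ℕ.< length (filter P? xs) →
                    ∃ λ x → x ∈ xs × P x
  filter-nonempty P? {xs} 0<len with filter P? xs in eq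
  ... | x ∷ _ = x , ∈-filter⁻ P? (≡.subst (x ∈_) (≡.sym eq) (here ≡.refl))

  columns : ℕ → ℕ
  columns zero    = 1
  columns (suc e) = # e

  boundary : ∀ e → Vector (Vector Carrier (columns e)) (# e)
  boundary zero    i _ = 1#
  boundary (suc e) i j = B e j i

  boundary-zero : ∀ (y : Vector Carrier 1) i → (boundary zero ⟪ y ⟫) i ≈ y zero
  boundary-zero y i = trans (+-identityʳ _) (*-identityˡ _)

  Im⇒boundary : ∀ e {x} → Im e x → ∃ λ y → x ≋ boundary e ⟪ y ⟫
  Im⇒boundary zero    (a , x≋a) = (λ _ → a) , λ i → trans (x≋a i) (sym (boundary-zero (λ _ → a) i))
  Im⇒boundary (suc e) x∈Im      = x∈Im

  boundary⇒Im : ∀ e {x} y → x ≋ boundary e ⟪ y ⟫ → Im e x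
  boundary⇒Im zero    y x≋ = y zero , λ i → trans (x≋ i) (boundary-zero y i)
  boundary⇒Im (suc e) y x≋ = y , x≋

  δ-matrix : ∀ e → Vector (Vector Carrier (# e)) (# (suc e))
  δ-matrix e j i = B e i j

  δ-boundary : ∀ e y → δ e (boundary e ⟪ y ⟫) ≋ 𝟎
  δ-boundary zero y j = begin-equality
    ⟨ δ-matrix zero j , boundary zero ⟪ y ⟫ ⟩
      ≈⟨ ⟨⟩-congʳ (δ-matrix zero j) (λ i → trans (boundary-zero y i) (sym (augmented i))) ⟩
    ⟨ δ-matrix zero j , (y zero * s) ⊛ (λ i → incidence ⊥ (simplex zero i)) ⟩
      ≈⟨ ⟨⟩-⊛ʳ (δ-matrix zero j) (y zero * s) (λ i → incidence ⊥ (simplex zero i)) ⟩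
    y zero * s * ⟨ δ-matrix zero j , (λ i → incidence ⊥ (simplex zero i)) ⟩
      ≈⟨ *-congˡ (incidence-B zero ⊥ j) ⟩
    y zero * s * 0#                              ≈⟨ zeroʳ _ ⟩
    0#                                           ∎
    where
    s = fromSign (Orientation.sign ω ⊥)
    augmented : ∀ i → y zero * s * incidence ⊥ (simplex zero i) ≈ y zero
    augmented i = trans (*-congˡ (incidence-vertex i)) (trans (*-assoc _ _ _)
      (trans (*-congˡ (fromSign-square (Orientation.sign ω ⊥))) (*-identityʳ _)))
  δ-boundary (suc e) y j = go y (λ k i → B e k i) (λ k → incidence-B (suc e) (simplex e k) j)
    where
    go : ∀ {m} (y : Vector Carrier m) (A : Fin m → Cochain (suc e)) →
         (∀ k → ⟨ δ-matrix (suc e) j , A k ⟩ ≈ 0#) →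
         ⟨ δ-matrix (suc e) j , (λ i → sum λ k → A k i * y k) ⟩ ≈ 0#
    go {zero}  y A h = ⟨⟩-𝟎ʳ (δ-matrix (suc e) j)
    go {suc m} y A h = begin-equality
      ⟨ δ-matrix (suc e) j , (λ i → sum λ k → A k i * y k) ⟩
        ≈⟨ ⟨⟩-⊕ʳ (δ-matrix (suc e) j) (λ i → A zero i * y zero) (λ i → sum λ k → A (suc k) i * y (suc k)) ⟩
      ⟨ δ-matrix (suc e) j , (λ i → A zero i * y zero) ⟩ +
      ⟨ δ-matrix (suc e) j , (λ i → sum λ k → A (suc k) i * y (suc k)) ⟩
        ≈⟨ +-cong (trans (⟨⟩-congʳ (δ-matrix (suc e) j) (λ i → *-comm _ _)) (⟨⟩-⊛ʳ (δ-matrix (suc e) j) (y zero) (A zero)))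
                  (go (y ∘ suc) (A ∘ suc) (h ∘ suc)) ⟩
      y zero * ⟨ δ-matrix (suc e) j , A zero ⟩ + 0#
        ≈⟨ trans (+-identityʳ _) (trans (*-congˡ (h zero)) (zeroʳ _)) ⟩
      0# ∎

  δ-cong : ∀ e {x y} → x ≋ y → δ e x ≋ δ e y
  δ-cong e x≋y j = ⟨⟩-congʳ (δ-matrix e j) x≋y

  Im⊆Ker : ∀ e {x} → Im e x → Ker e x
  Im⊆Ker e x∈Im with Im⇒boundary e x∈Im
  ... | y , x≋ = λ j → trans (δ-cong e x≋ j) (δ-boundary e y j)

  infimum-unique : ∀ {p} {S : Pred Carrier p} {a b} → IsInfimum S a → IsInfimum S b → a ≈ b
  infimum-unique (a-lower , a-greatest) (b-lower , b-greatest) =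
    ≤-antisym (b-greatest _ a-lower) (a-greatest _ b-lower)

  module _ (0<#d : 0 ℕ.< # d) (0<deg : ∀ τ → 0 ℕ.< deg d τ) where

    open Distance (boundary d) {w = λ τ → fromℕ (deg d τ)} (λ τ → fromℕ-positive (0<deg τ))

    private
      ∉Im⇒∉InImage : ∀ {x} → ¬ Im d x → ¬ InImage x
      ∉Im⇒∉InImage x∉Im (y , x≋) = x∉Im (boundary⇒Im d y x≋)

      τ₀ : Fin (# d)
      τ₀ = Fin.fromℕ< 0<#d

    basis∉Im : ¬ Im d (basis τ₀)
    basis∉Im e∈Im with filter-nonempty (simplex d τ₀ ⊆?_) {xs = simplices (suc d)} (0<deg τ₀)
    ... | σ , σ∈ , τ⊆σ with ∈-simplices⁻ σ∈
    ... | σ-face , σ-size with simplex-surjective σ-face σ-size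
    ... | j , ≡.refl
      with incidence-facet (⊆∧∣∣≡1+⇒IsFacet τ⊆σ (≡.trans σ-size (≡.cong suc (≡.sym (proj₂ (simplex-isFace d τ₀))))))
    ... | s , B≡s = fromSign≉0 s (begin-equality
      fromSign s                       ≡⟨ B≡s ⟨
      B d τ₀ j                         ≈⟨ ⟨⟩-basisʳ (δ-matrix d j) τ₀ ⟨
      δ d (basis τ₀) j                 ≈⟨ Im⊆Ker d e∈Im j ⟩
      0#                               ∎)

    open Cheeger (δ-matrix d) (λ j i → incidence-integer (simplex d i) (simplex (suc d) j))
                 (integral-basis τ₀) (∉Im⇒∉InImage basis∉Im)

    private
      f : Cochain d → Carrier
      f x = ‖ δ d x ‖₁

      x★ = minimiser

      x★∉Im : ¬ Im d x★
      x★∉Im x★∈Im = <⇒≉ 0<dist-minimiser (InImage⇒dist≈0 (Im⇒boundary d x★∈Im))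

      δ-reduced : ∀ x → δ d (reduced x) ≋ δ d x
      δ-reduced x j = trans (⟨⟩-⊕ʳ (δ-matrix d j) x (boundary d ⟪ projection x ⟫))
        (trans (+-congˡ (δ-boundary d (projection x) j)) (+-identityʳ (δ d x j)))

    isDist : ∀ x → IsDist d x (dist x)
    isDist x =
      (λ { r (z , z∈Im , r≈) → let (y , z≋) = Im⇒boundary d z∈Im in begin
        dist x                         ≤⟨ dist-≤ x y ⟩
        norm (x ⊕ boundary d ⟪ y ⟫)
          ≈⟨ norm-cong {x ⊕ boundary d ⟪ y ⟫} {x ⊕ z} (λ i → +-congˡ (sym (z≋ i))) ⟩
        norm (x ⊕ z)                   ≈⟨ r≈ ⟨
        r                              ∎ }) ,
      (λ b lower → lower (dist x)
        (boundary d ⟪ projection x ⟫ , boundary⇒Im d (projection x) (λ _ → refl) , refl))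

    private
      quotient-bound : ∀ {x a m r} → m ≈ dist x → a ≈ f x → IsQuotient a m r → cheeger ≤ r
      quotient-bound {x} {a} {m} {r} m≈ a≈ (m≉0 , rm≈a) = *-cancelˡ-≤ {k = m}
        (≤∧≉⇒< (≤-trans (dist-nonNegative x) (≤-reflexive (sym m≈))) m≉0)
        (begin
          m * cheeger        ≈⟨ *-comm _ _ ⟩
          cheeger * m        ≈⟨ *-congˡ m≈ ⟩
          cheeger * dist x   ≤⟨ cheeger-bound x ⟩
          f x                ≈⟨ a≈ ⟨
          a                  ≈⟨ rm≈a ⟨
          r * m              ≈⟨ *-comm _ _ ⟩
          m * r              ∎)

      quotient-attained : IsQuotient (f x★) (dist x★) cheeger
      quotient-attained = <⇒≉ 0<dist-minimiser , cheeger-attained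

    isCheegerConstant : IsCheegerConstant d cheeger
    isCheegerConstant =
      (λ { r (x , _ , m , m-dist , quotient) →
        quotient-bound {x} (infimum-unique m-dist (isDist x)) refl quotient }) ,
      (λ b lower → lower cheeger (x★ , x★∉Im , dist x★ , isDist x★ , quotient-attained))

    integral-minimum : IsMinimum (IntegralRatios d) cheeger
    integral-minimum =
      (x★ , ((λ i → proj₁ (minimiser-integral i)) , (λ i → proj₂ (minimiser-integral i)))
          , x★∉Im , dist x★ , isDist x★ , quotient-attained) ,
      (λ { r (x , _ , _ , m , m-dist , quotient) →
        quotient-bound {x} (infimum-unique m-dist (isDist x)) refl quotient })

    perp⇒norm≈dist : ∀ {x} → Perp¹ d x (Im d) → norm x ≈ dist x
    perp⇒norm≈dist {x} (u , u∈∇ , u⊥Im) = ≤-antisym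
      (begin
        norm x                                        ≈⟨ +-identityʳ _ ⟨
        norm x + 0#
          ≈⟨ +-congˡ (u⊥Im z (boundary⇒Im d (projection x) (λ _ → refl))) ⟨
        norm x + ⟨ u , z ⟩
          ≈⟨ +-congˡ (⟨⟩-congʳ u (λ i → solve 2 (λ x z → z := (x :+ z) :- x) refl (x i) (z i))) ⟩
        norm x + ⟨ u , (λ i → (x i + z i) + - x i) ⟩  ≤⟨ u∈∇ (reduced x) ⟩
        dist x                                        ∎)
      (≤-trans (dist-≤ x 𝟎) (≤-reflexive (norm-cong {y = x}
        (λ i → trans (+-congˡ (⟨⟩-𝟎ʳ (boundary d i))) (+-identityʳ (x i))))))
      where z = boundary d ⟪ projection x ⟫

    subgradient⇒perp : ∀ x → (∃ λ u → (∀ y → norm x + ⟨ u , y ⟩ ≤ norm (x ⊕ y)) ×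
                                      (∀ y → ⟨ u , boundary d ⟪ y ⟫ ⟩ ≈ 0#)) → Perp¹ d x (Im d)
    subgradient⇒perp x (u , subgradient , orthogonal) = u ,
      (λ y → ≤-trans (subgradient (λ i → y i + - x i))
        (≤-reflexive (norm-cong {x ⊕ (λ i → y i + - x i)} {y} (λ i →
          solve 2 (λ x y → x :+ (y :- x) := y) refl (x i) (y i))))) ,
      (λ y y∈Im → let (z , y≋) = Im⇒boundary d y∈Im in trans (⟨⟩-congʳ u y≋) (orthogonal z))

    reduced-perp : ∀ x → Perp¹ d (reduced x) (Im d)
    reduced-perp x = subgradient⇒perp (reduced x) (orthogonalSubgradient (boundary d)
      (weightedNorm-isSublinear (λ τ → fromℕ-nonNegative (deg d τ))) norm-nonNegative (reduced x) (reduced-minimal x))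

    orthogonal-minimum : IsMinimum (OrthogonalRatios d) cheeger
    orthogonal-minimum =
      (reduced x★ , reduced≉𝟎 , reduced-perp x★ , <⇒≉ 0<dist-minimiser ,
        trans cheeger-attained (‖‖₁-cong (λ j → sym (δ-reduced x★ j)))) ,
      (λ { r (x , _ , perp , quotient) → quotient-bound {x} (perp⇒norm≈dist {x} perp) refl quotient })
      where
      reduced≉𝟎 : ¬ reduced x★ ≋ 𝟎
      reduced≉𝟎 reduced≋𝟎 =
        0<dist-minimiser (≤-reflexive (trans (norm-cong {reduced x★} {𝟎} reduced≋𝟎) norm-𝟎))

    cheeger≈0⇒Ker⊈Im : cheeger ≈ 0# → ¬ CohomologyZero d
    cheeger≈0⇒Ker⊈Im h≈0 Ker⊆Im = x★∉Im (Ker⊆Im (‖‖₁≈0⇒≋𝟎 (begin-equality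
      f x★               ≈⟨ cheeger-attained ⟨
      cheeger * dist x★  ≈⟨ *-congʳ h≈0 ⟩
      0# * dist x★       ≈⟨ zeroˡ _ ⟩
      0#                 ∎)))

    cheeger≉0⇒Ker⊆Im : ¬ cheeger ≈ 0# → CohomologyZero d
    cheeger≉0⇒Ker⊆Im h≉0 {x} x∈Ker = boundary⇒Im d (proj₁ x∈InImage) (proj₂ x∈InImage)
      where
      h*dist≈0 : cheeger * dist x ≈ 0#
      h*dist≈0 = ≤-antisym (≤-trans (cheeger-bound x) (≤-reflexive (≋𝟎⇒‖‖₁≈0 x∈Ker)))
        (*-nonNegative cheeger-nonNegative (dist-nonNegative x))

      x∈InImage : InImage x
      x∈InImage = dist≈0⇒InImage {x} (*-cancelˡ-≈0 h≉0 h*dist≈0)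

    cheeger≈0⇔cohomology : cheeger ≈ 0# ⇔ CohomologyNonzero d
    cheeger≈0⇔cohomology = mk⇔ to from
      where
      to : cheeger ≈ 0# → CohomologyNonzero d
      to h≈0 = (λ {x} → Im⊆Ker d {x}) , cheeger≈0⇒Ker⊈Im h≈0

      from : CohomologyNonzero d → cheeger ≈ 0#
      from (_ , Ker⊈Im) =
        decidable-stable (cheeger ≟ 0#) (λ h≉0 → Ker⊈Im (λ {x} → cheeger≉0⇒Ker⊆Im h≉0 {x}))

    module _ (Ker⊆Im : CohomologyZero d) where

      isFil : ∀ {y w} → y ≋ δ d w → IsFil d y (dist w)
      isFil {y} {w} y≋ =
        (λ { r (x , δx≋y , r≈) → ≤-trans (dist-≤-norm x δx≋y) (≤-reflexive (sym r≈)) }) ,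
        (λ b b-lower → b-lower (dist w) (reduced w , (λ j → trans (δ-reduced w j) (sym (y≋ j))) , refl))
        where
        dist-≤-norm : ∀ x → δ d x ≋ y → dist w ≤ norm x
        dist-≤-norm x δx≋y = begin
          dist w                           ≤⟨ dist-≤ w (proj₁ z) ⟩
          norm (w ⊕ boundary d ⟪ proj₁ z ⟫) ≈⟨ norm-cong {w ⊕ boundary d ⟪ proj₁ z ⟫} {x} (λ i →
            trans (+-congˡ (sym (proj₂ z i))) (solve 2 (λ x w → w :+ (x :- w) := x) refl (x i) (w i))) ⟩
          norm x                           ∎
          where
          x-w∈Ker : Ker d (x ⊕ ⊖ w)
          x-w∈Ker j = begin-equality
            δ d (x ⊕ ⊖ w) j           ≈⟨ ⟨⟩-⊕ʳ (δ-matrix d j) x (⊖ w) ⟩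
            δ d x j + δ d (⊖ w) j     ≈⟨ +-cong (trans (δx≋y j) (y≋ j)) (⟨⟩-⊖ʳ (δ-matrix d j) w) ⟩
            δ d w j + - δ d w j       ≈⟨ -‿inverseʳ (δ d w j) ⟩
            0#                        ∎

          z : InImage (x ⊕ ⊖ w)
          z = Im⇒boundary d (Ker⊆Im x-w∈Ker)

      private
        δx★≉𝟎 : ¬ δ d x★ ≋ 𝟎
        δx★≉𝟎 = x★∉Im ∘ Ker⊆Im

        0<cheeger : 0# 𝔽.< cheeger
        0<cheeger = ≤∧≉⇒< cheeger-nonNegative (λ h≈0 → cheeger≈0⇒Ker⊈Im h≈0 Ker⊆Im)

      filling-minimum : IsMinimum (FillingRatios d) cheeger
      filling-minimum =
        (δ d x★ , (x★ , λ _ → refl) , δx★≉𝟎 , dist x★ , isFil (λ _ → refl) , quotient-attained) ,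
        (λ { r (y , (w , y≋) , _ , m , m-fil , quotient) →
          quotient-bound {w} (infimum-unique m-fil (isFil y≋)) (‖‖₁-cong y≋) quotient })

      inverse-maximum : ∀ {M} → cheeger * M ≈ 1# → 0# ≤ M → IsMaximum (InverseFillingRatios d) M
      inverse-maximum {M} hM≈1 0≤M =
        (δ d x★ , (x★ , λ _ → refl) , δx★≉𝟎 , dist x★ , isFil (λ _ → refl) , (δx★≉𝟎 ∘ ‖‖₁≈0⇒≋𝟎) , (begin-equality
          M * f x★                   ≈⟨ *-congˡ cheeger-attained ⟨
          M * (cheeger * dist x★)    ≈⟨ cancel (dist x★) ⟩
          dist x★                    ∎)) ,
        (λ { r (y , (w , y≋) , _ , m , m-fil , ‖y‖≉0 , r‖y‖≈m) →
          *-cancelˡ-≤ {‖ y ‖₁} (≤∧≉⇒< (‖‖₁-nonNegative y) ‖y‖≉0) (begin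
            ‖ y ‖₁ * r                 ≈⟨ *-comm ‖ y ‖₁ r ⟩
            r * ‖ y ‖₁                 ≈⟨ r‖y‖≈m ⟩
            m                          ≈⟨ infimum-unique m-fil (isFil y≋) ⟩
            dist w                     ≈⟨ cancel (dist w) ⟨
            M * (cheeger * dist w)     ≤⟨ *-monoˡ-≤ 0≤M (cheeger-bound w) ⟩
            M * f w                    ≈⟨ *-congˡ (‖‖₁-cong y≋) ⟨
            M * ‖ y ‖₁                 ≈⟨ *-comm M ‖ y ‖₁ ⟩
            ‖ y ‖₁ * M                 ∎) })
        where
        cancel : ∀ x → M * (cheeger * x) ≈ x
        cancel x = trans (solve 3 (λ M h x → M :* (h :* x) := h :* M :* x) refl M cheeger x)
          (trans (*-congʳ hM≈1) (*-identityˡ x))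

      inverse-filling-maximum : ∃ λ M → IsMaximum (InverseFillingRatios d) M × IsQuotient 1# M cheeger
      inverse-filling-maximum =
        let (M , hM≈1 , 0≤M) = inverse-positive 0<cheeger in
        M , inverse-maximum hM≈1 0≤M ,
        (λ M≈0 → 0≉1 (trans (sym (zeroʳ cheeger)) (trans (*-congˡ (sym M≈0)) hM≈1))) , hM≈1

open import Data.Nat.Base using (_<_)

mainTheorem4 : ∀ {c ℓ₁ ℓ₂ : Level} (ℝ : CompleteOrderedField c ℓ₁ ℓ₂)
    {n : ℕ} (K : SimplicialComplex n) (ω : Orientation n) (d : ℕ) →
    let open CompleteOrderedField ℝ
        open Cochains ℝ K ω
    in 0 < # d →
    (∀ τ → 0 < deg d τ) →
    ∃ λ h → IsCheegerConstant d h
    × IsMinimum (IntegralRatios d) h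
    × IsMinimum (OrthogonalRatios d) h
    × (h ≈ 0# ⇔ CohomologyNonzero d)
    × (CohomologyZero d →
    IsMinimum (FillingRatios d) h
    × ∃ λ M → IsMaximum (InverseFillingRatios d) M × IsQuotient 1# M h)
mainTheorem4 ℝ K ω d 0<#d 0<deg =
  _ , isCheegerConstant 0<#d 0<deg , integral-minimum 0<#d 0<deg , orthogonal-minimum 0<#d 0<deg
    , cheeger≈0⇔cohomology 0<#d 0<deg
    , λ Ker⊆Im → filling-minimum 0<#d 0<deg Ker⊆Im , inverse-filling-maximum 0<#d 0<deg Ker⊆Im
  where open CheegerConstantOfComplex ℝ K ω d
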